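{- Let $m\geq2$ be a power of two, let $a\geq4$ be an integer, and let $c\in\mathbb R$ satisfy $2+\frac1a<c<a$. Then there is a $4$-permutable set $S_{m,a,c}\subseteq\mathbb Z$ such that $$\underline d_{\mathbb Z}(S_{m,a,c})=1-\frac{a(c-1)}{2mc(a-1)}.$$
   Context: An $\omega$-permutation of a countably infinite set $S$ of integers is a sequence $p_0,p_1,\ldots$ of elements of $S$ in which every element of $S$ occurs exactly once. It contains a monotone arithmetic progression of length $\ell$ if there are indices $i_0<i_1<\cdots<i_{\ell-1}$, $x\in\mathbb Z$ and $d\in\mathbb Z\setminus\{0\}$ such that $p_{i_j}=x+jd$ for all $0\leq j<\ell$. A countably infinite set $S$ is $\ell$-permutable if it has an $\omega$-permutation containing no monotone arithmetic progression of length $\ell$. For $T\subseteq\mathbb Z$, $\underline d_{\mathbb Z}(T)=\liminf_{n\to\infty}|T\cap[-n,n]|/(2n+1)$. -}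

module Defs where

open import Data.Fin as Fin using (Fin; toℕ)
open import Data.Integer as ℤ using (ℤ; +_; 0ℤ)
import Data.Integer.Properties as ℤₚ
open import Data.List using (List; map; filter; length; upTo)
open import Data.Nat as ℕ using (ℕ; suc; _⊔_)
import Data.Nat.Properties as ℕₚ
open import Data.Product using (Σ-syntax; ∃-syntax; ∃!; _×_; _,_; proj₁; proj₂)
open import Data.Rational as ℚ using (ℚ; 0ℚ; 1ℚ; ½; positive; nonNegative)
import Data.Rational.Properties as ℚₚ
import Data.Rational.Unnormalised as ℚᵘ
import Data.Rational.Unnormalised.Properties as ℚᵘₚ
open import Data.Rational.Solver using (module +-*-Solver)
open import Data.Sum using (inj₁; inj₂)
open import Level using (0ℓ)
open import Relation.Binary.PropositionalEquality
  using (_≡_; _≢_; refl; sym; trans; cong; subst; subst₂)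
open import Relation.Nullary using (¬_; yes; no; contradiction)
open import Relation.Unary using (Pred; Decidable; _∈_)

0<* : ∀ {p q} → 0ℚ ℚ.< p → 0ℚ ℚ.< q → 0ℚ ℚ.< p ℚ.* q
0<* {p} {q} p>0 q>0 =
  ℚₚ.positive⁻¹ (p ℚ.* q)
    {{ℚₚ.pos*pos⇒pos p {{positive p>0}} q {{positive q>0}}}}

0<½* : ∀ {ε} → 0ℚ ℚ.< ε → 0ℚ ℚ.< ½ ℚ.* ε
0<½* = 0<* (ℚₚ.positive⁻¹ ½)

½+½ : ∀ ε → ½ ℚ.* ε ℚ.+ ½ ℚ.* ε ≡ ε
½+½ ε = trans (sym (ℚₚ.*-distribʳ-+ ε ½ ½)) (ℚₚ.*-identityˡ ε)

<½+<½ : ∀ {p q ε} → p ℚ.< ½ ℚ.* ε → q ℚ.< ½ ℚ.* ε → p ℚ.+ q ℚ.< ε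
<½+<½ {p} {q} {ε} h k = subst (p ℚ.+ q ℚ.<_) (½+½ ε) (ℚₚ.+-mono-< h k)

∣p∣<1+∣p∣ : ∀ p → ℚ.∣ p ∣ ℚ.< 1ℚ ℚ.+ ℚ.∣ p ∣
∣p∣<1+∣p∣ p = subst (ℚ._< 1ℚ ℚ.+ ℚ.∣ p ∣) (ℚₚ.+-identityˡ ℚ.∣ p ∣)
  (ℚₚ.+-monoˡ-< ℚ.∣ p ∣ (ℚₚ.positive⁻¹ 1ℚ))

∣p-q∣≡∣q-p∣ : ∀ p q → ℚ.∣ p ℚ.- q ∣ ≡ ℚ.∣ q ℚ.- p ∣
∣p-q∣≡∣q-p∣ p q = trans (sym (ℚₚ.∣-p∣≡∣p∣ (p ℚ.- q)))
  (cong ℚ.∣_∣ (solve 2 (λ a b → :- (a :- b) := b :- a) refl p q))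
  where open +-*-Solver

∣p∣≤∣p-q∣+∣q∣ : ∀ p q → ℚ.∣ p ∣ ℚ.≤ ℚ.∣ p ℚ.- q ∣ ℚ.+ ℚ.∣ q ∣
∣p∣≤∣p-q∣+∣q∣ p q =
  subst (ℚ._≤ ℚ.∣ p ℚ.- q ∣ ℚ.+ ℚ.∣ q ∣)
    (cong ℚ.∣_∣ (solve 2 (λ a b → (a :- b) :+ b := a) refl p q))
    (ℚₚ.∣p+q∣≤∣p∣+∣q∣ (p ℚ.- q) q)
  where open +-*-Solver

∣p∣-∣q∣≤∣p-q∣ : ∀ p q → ℚ.∣ p ∣ ℚ.- ℚ.∣ q ∣ ℚ.≤ ℚ.∣ p ℚ.- q ∣
∣p∣-∣q∣≤∣p-q∣ p q =
  subst (ℚ.∣ p ∣ ℚ.- ℚ.∣ q ∣ ℚ.≤_)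
    (solve 2 (λ a b → (a :+ b) :- b := a) refl ℚ.∣ p ℚ.- q ∣ ℚ.∣ q ∣)
    (ℚₚ.+-monoˡ-≤ (ℚ.- ℚ.∣ q ∣) (∣p∣≤∣p-q∣+∣q∣ p q))
  where open +-*-Solver

∣∣p∣-∣q∣∣≤∣p-q∣ : ∀ p q → ℚ.∣ ℚ.∣ p ∣ ℚ.- ℚ.∣ q ∣ ∣ ℚ.≤ ℚ.∣ p ℚ.- q ∣
∣∣p∣-∣q∣∣≤∣p-q∣ p q with ℚₚ.∣p∣≡p∨∣p∣≡-p (ℚ.∣ p ∣ ℚ.- ℚ.∣ q ∣)
... | inj₁ e = subst (ℚ._≤ ℚ.∣ p ℚ.- q ∣) (sym e) (∣p∣-∣q∣≤∣p-q∣ p q)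
... | inj₂ e = subst₂ ℚ._≤_
  (sym (trans e (solve 2 (λ a b → :- (a :- b) := b :- a) refl ℚ.∣ p ∣ ℚ.∣ q ∣)))
  (∣p-q∣≡∣q-p∣ q p) (∣p∣-∣q∣≤∣p-q∣ q p)
  where open +-*-Solver

recip : ℚ → ℚ
recip p with p ℚₚ.≟ 0ℚ
... | yes _  = 0ℚ
... | no p≢0 = ℚ.1/_ p {{ℚ.≢-nonZero p≢0}}

*-recip : ∀ {p} → 0ℚ ℚ.< p → p ℚ.* recip p ≡ 1ℚ
*-recip {p} p>0 with p ℚₚ.≟ 0ℚ
... | yes p≡0 = contradiction (sym p≡0) (ℚₚ.<⇒≢ p>0)
... | no p≢0  = ℚₚ.*-inverseʳ p {{ℚ.≢-nonZero p≢0}}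

recip>0 : ∀ {p} → 0ℚ ℚ.< p → 0ℚ ℚ.< recip p
recip>0 {p} p>0 with p ℚₚ.≟ 0ℚ
... | yes p≡0 = contradiction (sym p≡0) (ℚₚ.<⇒≢ p>0)
... | no _    = ℚₚ.positive⁻¹ _ {{ℚₚ.1/pos⇒pos p {{positive p>0}}}}

*-mono-≤-< : ∀ {a b c d} → 0ℚ ℚ.≤ c → 0ℚ ℚ.< b →
  a ℚ.≤ b → c ℚ.< d → a ℚ.* c ℚ.< b ℚ.* d
*-mono-≤-< {a} {b} {c} {d} c≥0 b>0 a≤b c<d = ℚₚ.≤-<-trans
  (ℚₚ.*-monoʳ-≤-nonNeg c {{nonNegative c≥0}} a≤b)
  (ℚₚ.*-monoʳ-<-pos b {{positive b>0}} c<d)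

*-mono-< : ∀ {a b c d} → 0ℚ ℚ.< b → 0ℚ ℚ.< c →
  a ℚ.< b → c ℚ.< d → a ℚ.* c ℚ.< b ℚ.* d
*-mono-< b>0 c>0 a<b c<d = *-mono-≤-< (ℚₚ.<⇒≤ c>0) b>0 (ℚₚ.<⇒≤ a<b) c<d

∣*∣<-scaled : ∀ {B ε} p q → 0ℚ ℚ.< B → ℚ.∣ p ∣ ℚ.< B →
  ℚ.∣ q ∣ ℚ.< recip B ℚ.* ε → ℚ.∣ p ℚ.* q ∣ ℚ.< ε
∣*∣<-scaled {B} {ε} p q B>0 hp hq =
  subst₂ ℚ._<_ (sym (ℚₚ.∣p*q∣≡∣p∣*∣q∣ p q)) scale
    (*-mono-≤-< {ℚ.∣ p ∣} {B} {ℚ.∣ q ∣} {recip B ℚ.* ε}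
      (ℚₚ.0≤∣p∣ q) B>0 (ℚₚ.<⇒≤ hp) hq)
  where
  scale : B ℚ.* (recip B ℚ.* ε) ≡ ε
  scale = trans (sym (ℚₚ.*-assoc B (recip B) ε))
    (trans (cong (ℚ._* ε) (*-recip B>0)) (ℚₚ.*-identityˡ ε))

*-close : ∀ {A B ε} a b c d → 0ℚ ℚ.< A → 0ℚ ℚ.< B →
  ℚ.∣ a ∣ ℚ.< A → ℚ.∣ d ∣ ℚ.< B →
  ℚ.∣ a ℚ.- b ∣ ℚ.< recip B ℚ.* (½ ℚ.* ε) →
  ℚ.∣ c ℚ.- d ∣ ℚ.< recip A ℚ.* (½ ℚ.* ε) →
  ℚ.∣ a ℚ.* c ℚ.- b ℚ.* d ∣ ℚ.< ε
*-close {A} {B} {ε} a b c d A>0 B>0 ha hd hab hcd = ℚₚ.≤-<-trans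
  (subst (ℚ._≤ ℚ.∣ a ℚ.* (c ℚ.- d) ∣ ℚ.+ ℚ.∣ d ℚ.* (a ℚ.- b) ∣)
    (cong ℚ.∣_∣ (solve 4 (λ a b c d →
        a :* (c :- d) :+ d :* (a :- b) := a :* c :- b :* d) refl a b c d))
    (ℚₚ.∣p+q∣≤∣p∣+∣q∣ (a ℚ.* (c ℚ.- d)) (d ℚ.* (a ℚ.- b))))
  (<½+<½ {ε = ε} (∣*∣<-scaled {A} {½ ℚ.* ε} a (c ℚ.- d) A>0 ha hcd)
                 (∣*∣<-scaled {B} {½ ℚ.* ε} d (a ℚ.- b) B>0 hd hab))
  where open +-*-Solver

recip-close : ∀ {δ ε p q} → 0ℚ ℚ.< δ → 0ℚ ℚ.< ε → δ ℚ.< p → δ ℚ.< q →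
  ℚ.∣ p ℚ.- q ∣ ℚ.< ε ℚ.* (δ ℚ.* δ) → ℚ.∣ recip p ℚ.- recip q ∣ ℚ.< ε
recip-close {δ} {ε} {p} {q} δ>0 ε>0 δ<p δ<q h =
  ℚₚ.*-cancelʳ-<-nonNeg (p ℚ.* q) {{nonNegative (ℚₚ.<⇒≤ pq>0)}}
    (subst (ℚ._< ε ℚ.* (p ℚ.* q)) (sym scaled)
      (ℚₚ.<-trans h (ℚₚ.*-monoʳ-<-pos ε {{positive ε>0}}
        (*-mono-< p>0 δ>0 δ<p δ<q))))
  where
  open +-*-Solver
  p>0  = ℚₚ.<-trans δ>0 δ<p
  q>0  = ℚₚ.<-trans δ>0 δ<q
  pq>0 = 0<* p>0 q>0
  r s : ℚ
  r = recip p
  s = recip q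
  cross : (r ℚ.- s) ℚ.* (p ℚ.* q) ≡ q ℚ.- p
  cross = trans
    (solve 4 (λ r s p q →
        (r :- s) :* (p :* q) := (p :* r) :* q :- (q :* s) :* p) refl r s p q)
    (trans (cong (λ z → z ℚ.* q ℚ.- (q ℚ.* s) ℚ.* p) (*-recip p>0))
      (trans (cong (λ z → 1ℚ ℚ.* q ℚ.- z ℚ.* p) (*-recip q>0))
        (solve 2 (λ p q → con 1ℚ :* q :- con 1ℚ :* p := q :- p) refl p q)))
  scaled : ℚ.∣ r ℚ.- s ∣ ℚ.* (p ℚ.* q) ≡ ℚ.∣ p ℚ.- q ∣
  scaled = trans
    (cong (ℚ.∣ r ℚ.- s ∣ ℚ.*_) (sym (ℚₚ.0≤p⇒∣p∣≡p (ℚₚ.<⇒≤ pq>0))))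
    (trans (sym (ℚₚ.∣p*q∣≡∣p∣*∣q∣ (r ℚ.- s) (p ℚ.* q)))
      (trans (cong ℚ.∣_∣ cross) (∣p-q∣≡∣q-p∣ q p)))

recip-anti : ∀ {p q} → 0ℚ ℚ.< p → 0ℚ ℚ.< q → p ℚ.< q → recip q ℚ.< recip p
recip-anti {p} {q} p>0 q>0 p<q =
  ℚₚ.*-cancelʳ-<-nonNeg (p ℚ.* q) {{nonNegative (ℚₚ.<⇒≤ (0<* p>0 q>0))}}
    (subst₂ ℚ._<_ (sym lhs) (sym rhs) p<q)
  where
  open +-*-Solver
  lhs : recip q ℚ.* (p ℚ.* q) ≡ p
  lhs = trans (solve 3 (λ r p q → r :* (p :* q) := p :* (q :* r)) refl (recip q) p q)
    (trans (cong (p ℚ.*_) (*-recip q>0)) (ℚₚ.*-identityʳ p))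
  rhs : recip p ℚ.* (p ℚ.* q) ≡ q
  rhs = trans (solve 3 (λ r p q → r :* (p :* q) := q :* (p :* r)) refl (recip p) p q)
    (trans (cong (q ℚ.*_) (*-recip p>0)) (ℚₚ.*-identityʳ q))

-- Real numbers are Cauchy sequences of rationals.  Distinct sequences
-- may represent the same number, so reals are only ever compared through
-- the order relations below, never through _≡_.  The strict order carries
-- a rational gap valid from some index on.

IsCauchy : (ℕ → ℚ) → Set
IsCauchy s = ∀ ε → 0ℚ ℚ.< ε →
  ∃[ N ] (∀ i j → N ℕ.≤ i → N ℕ.≤ j → ℚ.∣ s i ℚ.- s j ∣ ℚ.< ε)

record ℝ : Set where
  constructor mkℝ
  field
    approx : ℕ → ℚ
    cauchy : IsCauchy approx

open ℝ public

infix  4 _<_ _≤_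
infixl 6 _+_ _-_
infixl 7 _*_ _/_[_]
infix  8 -_

record _<_ (x y : ℝ) : Set where
  constructor mk<
  field
    gap   : ℚ
    gap>0 : 0ℚ ℚ.< gap
    start : ℕ
    below : ∀ n → start ℕ.≤ n → approx x n ℚ.+ gap ℚ.< approx y n

_≤_ : ℝ → ℝ → Set
x ≤ y = ¬ (y < x)

fromℚ : ℚ → ℝ
fromℚ q = mkℝ (λ _ → q) λ ε ε>0 → 0 , λ _ _ _ _ →
  subst (ℚ._< ε) (sym (cong ℚ.∣_∣ (ℚₚ.+-inverseʳ q))) ε>0

fromℕ : ℕ → ℝ
fromℕ n = fromℚ (+ n ℚ./ 1)

0ℝ : ℝ
0ℝ = fromℚ 0ℚ

_+_ : ℝ → ℝ → ℝ
x + y = mkℝ (λ n → approx x n ℚ.+ approx y n) close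
  where
  open +-*-Solver
  close : IsCauchy (λ n → approx x n ℚ.+ approx y n)
  close ε ε>0 with cauchy x (½ ℚ.* ε) (0<½* ε>0) | cauchy y (½ ℚ.* ε) (0<½* ε>0)
  ... | M , hx | N , hy = M ⊔ N , λ i j i≥ j≥ → ℚₚ.≤-<-trans
    (subst (ℚ._≤ ℚ.∣ approx x i ℚ.- approx x j ∣ ℚ.+ ℚ.∣ approx y i ℚ.- approx y j ∣)
      (cong ℚ.∣_∣ (solve 4 (λ a b c d → (a :- b) :+ (c :- d) := (a :+ c) :- (b :+ d))
        refl (approx x i) (approx x j) (approx y i) (approx y j)))
      (ℚₚ.∣p+q∣≤∣p∣+∣q∣ (approx x i ℚ.- approx x j) (approx y i ℚ.- approx y j)))
    (<½+<½ (hx i j (ℕₚ.m⊔n≤o⇒m≤o M N i≥) (ℕₚ.m⊔n≤o⇒m≤o M N j≥))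
           (hy i j (ℕₚ.m⊔n≤o⇒n≤o M N i≥) (ℕₚ.m⊔n≤o⇒n≤o M N j≥)))

-_ : ℝ → ℝ
- x = mkℝ (λ n → ℚ.- approx x n) λ ε ε>0 →
  proj₁ (cauchy x ε ε>0) , λ i j i≥ j≥ →
    subst (ℚ._< ε)
      (trans (∣p-q∣≡∣q-p∣ (approx x i) (approx x j))
        (cong ℚ.∣_∣ (solve 2 (λ a b → b :- a := (:- a) :- (:- b))
          refl (approx x i) (approx x j))))
      (proj₂ (cauchy x ε ε>0) i j i≥ j≥)
  where open +-*-Solver

_-_ : ℝ → ℝ → ℝ
x - y = x + (- y)

∣_∣ : ℝ → ℝ
∣ x ∣ = mkℝ (λ n → ℚ.∣ approx x n ∣) λ ε ε>0 →
  proj₁ (cauchy x ε ε>0) , λ i j i≥ j≥ →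
    ℚₚ.≤-<-trans (∣∣p∣-∣q∣∣≤∣p-q∣ (approx x i) (approx x j))
      (proj₂ (cauchy x ε ε>0) i j i≥ j≥)

eventually-bounded : ∀ x →
  ∃[ B ] (0ℚ ℚ.< B × ∃[ N ] (∀ n → N ℕ.≤ n → ℚ.∣ approx x n ∣ ℚ.< B))
eventually-bounded x with cauchy x 1ℚ (ℚₚ.positive⁻¹ 1ℚ)
... | N , h =
  1ℚ ℚ.+ ℚ.∣ approx x N ∣ ,
  ℚₚ.≤-<-trans (ℚₚ.0≤∣p∣ (approx x N)) (∣p∣<1+∣p∣ (approx x N)) ,
  N , λ n n≥ → ℚₚ.≤-<-trans (∣p∣≤∣p-q∣+∣q∣ (approx x n) (approx x N))
    (ℚₚ.+-monoˡ-< ℚ.∣ approx x N ∣ (h n N n≥ ℕₚ.≤-refl))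

_*_ : ℝ → ℝ → ℝ
x * y = mkℝ (λ n → approx x n ℚ.* approx y n) close
  where
  close : IsCauchy (λ n → approx x n ℚ.* approx y n)
  close ε ε>0 =
    let A , A>0 , K , hA = eventually-bounded x
        B , B>0 , L , hB = eventually-bounded y
        M , hx = cauchy x (recip B ℚ.* (½ ℚ.* ε)) (0<* (recip>0 B>0) (0<½* ε>0))
        N , hy = cauchy y (recip A ℚ.* (½ ℚ.* ε)) (0<* (recip>0 A>0) (0<½* ε>0))
    in (K ⊔ L) ⊔ (M ⊔ N) , λ i j i≥ j≥ →
    *-close (approx x i) (approx x j) (approx y i) (approx y j) A>0 B>0
      (hA i (ℕₚ.m⊔n≤o⇒m≤o K L (ℕₚ.m⊔n≤o⇒m≤o (K ⊔ L) (M ⊔ N) i≥)))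
      (hB j (ℕₚ.m⊔n≤o⇒n≤o K L (ℕₚ.m⊔n≤o⇒m≤o (K ⊔ L) (M ⊔ N) j≥)))
      (hx i j (ℕₚ.m⊔n≤o⇒m≤o M N (ℕₚ.m⊔n≤o⇒n≤o (K ⊔ L) (M ⊔ N) i≥))
              (ℕₚ.m⊔n≤o⇒m≤o M N (ℕₚ.m⊔n≤o⇒n≤o (K ⊔ L) (M ⊔ N) j≥)))
      (hy i j (ℕₚ.m⊔n≤o⇒n≤o M N (ℕₚ.m⊔n≤o⇒n≤o (K ⊔ L) (M ⊔ N) i≥))
              (ℕₚ.m⊔n≤o⇒n≤o M N (ℕₚ.m⊔n≤o⇒n≤o (K ⊔ L) (M ⊔ N) j≥)))

-- The approximations to a positive real may vanish at finitely many
-- indices, where recip returns 0.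
_⁻¹[_] : ∀ y → 0ℝ < y → ℝ
y ⁻¹[ mk< δ δ>0 M h ] = mkℝ (λ n → recip (approx y n)) close
  where
  δ<y : ∀ n → M ℕ.≤ n → δ ℚ.< approx y n
  δ<y n n≥ = subst (ℚ._< approx y n) (ℚₚ.+-identityˡ δ) (h n n≥)
  close : IsCauchy (λ n → recip (approx y n))
  close ε ε>0 with cauchy y (ε ℚ.* (δ ℚ.* δ)) (0<* ε>0 (0<* δ>0 δ>0))
  ... | N , hy = M ⊔ N , λ i j i≥ j≥ → recip-close δ>0 ε>0
    (δ<y i (ℕₚ.m⊔n≤o⇒m≤o M N i≥)) (δ<y j (ℕₚ.m⊔n≤o⇒m≤o M N j≥))
    (hy i j (ℕₚ.m⊔n≤o⇒n≤o M N i≥) (ℕₚ.m⊔n≤o⇒n≤o M N j≥))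

_/_[_] : ℝ → ∀ y → 0ℝ < y → ℝ
x / y [ y>0 ] = x * y ⁻¹[ y>0 ]

fromℕ-< : ∀ m n → m ℕ.< n → fromℕ m < fromℕ n
fromℕ-< m n m<n = mk< (½ ℚ.* d) (0<½* d>0) 0 λ _ _ → p+½d<q
  where
  open +-*-Solver
  p q d : ℚ
  p = + m ℚ./ 1
  q = + n ℚ./ 1
  d = q ℚ.- p
  p<q : p ℚ.< q
  p<q = ℚₚ.toℚᵘ-cancel-< (ℚᵘₚ.<-respˡ-≃ (ℚᵘₚ.≃-sym (ℚₚ.toℚᵘ-fromℚᵘ (ℚᵘ.mkℚᵘ (+ m) 0)))
    (ℚᵘₚ.<-respʳ-≃ (ℚᵘₚ.≃-sym (ℚₚ.toℚᵘ-fromℚᵘ (ℚᵘ.mkℚᵘ (+ n) 0)))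
      (ℚᵘ.*<* (ℤₚ.*-monoʳ-<-pos (+ 1) (ℤ.+<+ m<n)))))
  d>0 : 0ℚ ℚ.< d
  d>0 = subst (ℚ._< d) (ℚₚ.+-inverseʳ p) (ℚₚ.+-monoˡ-< (ℚ.- p) p<q)
  p+½d<q : p ℚ.+ ½ ℚ.* d ℚ.< q
  p+½d<q = subst₂ ℚ._<_ (ℚₚ.+-identityʳ _)
    (trans (solve 3 (λ p h q → p :+ h :+ h := p :+ (h :+ h)) refl p (½ ℚ.* d) q)
      (trans (cong (p ℚ.+_) (½+½ d))
        (solve 2 (λ p q → p :+ (q :- p) := q) refl p q)))
    (ℚₚ.+-monoʳ-< (p ℚ.+ ½ ℚ.* d) (0<½* d>0))

<-trans : ∀ {x y z} → x < y → y < z → x < z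
<-trans {x} {y} {z} (mk< δ δ>0 M h) (mk< η η>0 N k) =
  mk< δ δ>0 (M ⊔ N) λ n n≥ → ℚₚ.<-trans (h n (ℕₚ.m⊔n≤o⇒m≤o M N n≥))
    (ℚₚ.<-trans
      (subst (ℚ._< approx y n ℚ.+ η) (ℚₚ.+-identityʳ (approx y n))
        (ℚₚ.+-monoʳ-< (approx y n) η>0))
      (k n (ℕₚ.m⊔n≤o⇒n≤o M N n≥)))

<⇒0<- : ∀ {x y} → x < y → 0ℝ < y - x
<⇒0<- {x} {y} (mk< δ δ>0 N h) = mk< δ δ>0 N λ n n≥ →
  subst (ℚ._< approx y n ℚ.- approx x n)
    (solve 2 (λ a d → (a :+ d) :- a := con 0ℚ :+ d) refl (approx x n) δ)
    (ℚₚ.+-monoˡ-< (ℚ.- approx x n) (h n n≥))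
  where open +-*-Solver

*-pos : ∀ {x y} → 0ℝ < x → 0ℝ < y → 0ℝ < x * y
*-pos {x} {y} (mk< δ δ>0 M h) (mk< η η>0 N k) =
  mk< (δ ℚ.* η) (0<* δ>0 η>0) (M ⊔ N) λ n n≥ →
    let δ<x = subst (ℚ._< approx x n) (ℚₚ.+-identityˡ δ) (h n (ℕₚ.m⊔n≤o⇒m≤o M N n≥))
        η<y = subst (ℚ._< approx y n) (ℚₚ.+-identityˡ η) (k n (ℕₚ.m⊔n≤o⇒n≤o M N n≥))
    in subst (ℚ._< approx x n ℚ.* approx y n) (sym (ℚₚ.+-identityˡ (δ ℚ.* η)))
         (*-mono-< (ℚₚ.<-trans δ>0 δ<x) η>0 δ<x η<y)

+-pos : ∀ {x y} → 0ℝ < x → 0ℝ < y → 0ℝ < x + y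
+-pos {x} {y} (mk< δ δ>0 M h) (mk< η η>0 N k) =
  mk< (δ ℚ.+ η) (ℚₚ.+-mono-< δ>0 η>0) (M ⊔ N) λ n n≥ →
    subst (ℚ._< approx x n ℚ.+ approx y n)
      (solve 2 (λ d e → (con 0ℚ :+ d) :+ (con 0ℚ :+ e) := con 0ℚ :+ (d :+ e)) refl δ η)
      (ℚₚ.+-mono-< (h n (ℕₚ.m⊔n≤o⇒m≤o M N n≥)) (k n (ℕₚ.m⊔n≤o⇒n≤o M N n≥)))
  where open +-*-Solver

⁻¹-pos : ∀ {y} (y>0 : 0ℝ < y) → 0ℝ < y ⁻¹[ y>0 ]
⁻¹-pos {y} (mk< δ δ>0 M h) =
  let B , B>0 , N , hB = eventually-bounded y
  in mk< (recip B) (recip>0 B>0) (M ⊔ N) λ n n≥ →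
    bound {approx y n} B>0 (h n (ℕₚ.m⊔n≤o⇒m≤o M N n≥)) (hB n (ℕₚ.m⊔n≤o⇒n≤o M N n≥))
  where
  bound : ∀ {p B} → 0ℚ ℚ.< B → 0ℚ ℚ.+ δ ℚ.< p → ℚ.∣ p ∣ ℚ.< B →
    0ℚ ℚ.+ recip B ℚ.< recip p
  bound {p} {B} B>0 δ<p p<B =
    subst (ℚ._< recip p) (sym (ℚₚ.+-identityˡ (recip B)))
      (recip-anti p>0 B>0 (subst (ℚ._< B) (ℚₚ.0≤p⇒∣p∣≡p (ℚₚ.<⇒≤ p>0)) p<B))
    where
    p>0 : 0ℚ ℚ.< p
    p>0 = ℚₚ.<-trans δ>0 (subst (ℚ._< p) (ℚₚ.+-identityˡ δ) δ<p)

≥4⇒pos : ∀ {a} → 4 ℕ.≤ a → 0ℝ < fromℕ a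
≥4⇒pos {a} 4≤a = fromℕ-< 0 a (ℕₚ.<-≤-trans (ℕ.s≤s ℕ.z≤n) 4≤a)

denominator-pos : ∀ m a c → 2 ℕ.≤ m → (4≤a : 4 ℕ.≤ a) →
  fromℕ 2 + fromℕ 1 / fromℕ a [ ≥4⇒pos 4≤a ] < c →
  0ℝ < fromℕ 2 * fromℕ m * c * (fromℕ a - fromℕ 1)
denominator-pos m a c 2≤m 4≤a 2+1/a<c =
  *-pos {fromℕ 2 * fromℕ m * c} {fromℕ a - fromℕ 1}
    (*-pos {fromℕ 2 * fromℕ m} {c} (*-pos {fromℕ 2} {fromℕ m} 2>0 m>0) c>0) a-1>0
  where
  2>0 : 0ℝ < fromℕ 2
  2>0 = fromℕ-< 0 2 (ℕ.s≤s ℕ.z≤n)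
  m>0 : 0ℝ < fromℕ m
  m>0 = fromℕ-< 0 m (ℕₚ.<-≤-trans (ℕ.s≤s ℕ.z≤n) 2≤m)
  a-1>0 : 0ℝ < fromℕ a - fromℕ 1
  a-1>0 = <⇒0<- {fromℕ 1} {fromℕ a} (fromℕ-< 1 a (ℕₚ.<-≤-trans (ℕ.s≤s (ℕ.s≤s ℕ.z≤n)) 4≤a))
  1/a>0 : 0ℝ < fromℕ 1 / fromℕ a [ ≥4⇒pos 4≤a ]
  1/a>0 = *-pos {fromℕ 1} {fromℕ a ⁻¹[ ≥4⇒pos 4≤a ]}
    (fromℕ-< 0 1 (ℕ.s≤s ℕ.z≤n)) (⁻¹-pos {fromℕ a} (≥4⇒pos 4≤a))
  c>0 : 0ℝ < c
  c>0 = <-trans {0ℝ} {fromℕ 2 + fromℕ 1 / fromℕ a [ ≥4⇒pos 4≤a ]} {c}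
    (+-pos {fromℕ 2} {fromℕ 1 / fromℕ a [ ≥4⇒pos 4≤a ]} 2>0 1/a>0) 2+1/a<c

Converges : (ℕ → ℝ) → ℝ → Set
Converges x l = ∀ ε → 0ℝ < ε → ∃[ N ] (∀ n → N ℕ.≤ n → ∣ x n - l ∣ < ε)

IsTailInfimum : (ℕ → ℝ) → ℕ → ℝ → Set
IsTailInfimum x n y =
  (∀ k → n ℕ.≤ k → y ≤ x k) ×
  (∀ z → (∀ k → n ℕ.≤ k → z ≤ x k) → z ≤ y)

-- lim inf x = l, as the limit of the infima of the tails of x
LimInf : (ℕ → ℝ) → ℝ → Set
LimInf x l = ∃[ y ] ((∀ n → IsTailInfimum x n (y n)) × Converges y l)

record IsωPermutation (S : Pred ℤ 0ℓ) (p : ℕ → ℤ) : Set where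
  field
    mem  : ∀ i → p i ∈ S
    once : ∀ x → x ∈ S → ∃! _≡_ (λ i → p i ≡ x)

ContainsMonotoneAP : ℕ → (ℕ → ℤ) → Set
ContainsMonotoneAP ℓ p =
  Σ[ i ∈ (Fin ℓ → ℕ) ] Σ[ x ∈ ℤ ] Σ[ d ∈ ℤ ]
    ((∀ (j k : Fin ℓ) → j Fin.< k → i j ℕ.< i k) ×
     d ≢ 0ℤ ×
     (∀ (j : Fin ℓ) → p (i j) ≡ x ℤ.+ + toℕ j ℤ.* d))

Permutable : ℕ → Pred ℤ 0ℓ → Set
Permutable ℓ S = ∃[ p ] (IsωPermutation S p × ¬ ContainsMonotoneAP ℓ p)

symmetricInterval : ℕ → List ℤ
symmetricInterval n = map (λ i → + i ℤ.- + n) (upTo (suc (2 ℕ.* n)))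

-- T is decidable so that its elements in [-n, n] can be counted.
densityAt : (T : Pred ℤ 0ℓ) → Decidable T → ℕ → ℝ
densityAt T T? n =
  fromℚ (+ length (filter {P = T} T? (symmetricInterval n)) ℚ./ suc (2 ℕ.* n))

HasLowerDensity : (T : Pred ℤ 0ℓ) → Decidable T → ℝ → Set
HasLowerDensity T T? = LimInf (densityAt T T?)

{-# OPTIONS --safe #-}

-- Split the integers into streams by sign and residue modulo M = 2 ^ K, and cut
-- every stream into blocks by leaving out all its elements in certain intervals
-- [M 4 ^ j, M 4 ^ (j + 1)), the streams taking turns with j.  List the blocks
-- round by round, in each round the negative numbers by decreasing and then the
-- nonnegative numbers by increasing reversed binary digits.  Along a
-- progression the lowest nonzero digit of d alternates, so every second step
-- between terms of equal sign goes against the order inside a round.  Such a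
-- step needs a later round, hence multiplies the absolute value by at least 4;
-- for each pattern of signs of a 4-term progression this is impossible.
--
-- At each scale a single residue class of absolute values is missing.  Whole
-- blocks of M consecutive absolute values are removed in addition whenever the
-- number of removals up to n then stays below R n.  Hence all densities are at
-- least 1 - R, and they return arbitrarily close to 1 - R, so 1 - R is the
-- infimum of every tail.  This works for 1 / M ≤ R ≤ 1 / 2, and the rate
-- R = a (c - 1) / (2 m c (a - 1)) satisfies these bounds with M = 4 m.

module Submission where

open import Data.Bool as Bool using (Bool)
open import Data.Integer as ℤ using (ℤ)
open import Data.Nat as ℕ using (ℕ)
open import Data.Product using (Σ-syntax; ∃-syntax; _×_; _,_)
open import Data.Rational as ℚ using (ℚ; 0ℚ; 1ℚ)
open import Level using (0ℓ)
open import Relation.Binary.PropositionalEquality using (_≡_)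
open import Relation.Unary using (Pred; Decidable)

-- Reversed binary digits and their zigzag along progressions.

module BitReversal where

  open import Data.Bool using (Bool; true; false; not; if_then_else_)
  open import Data.Integer as ℤ using (ℤ; +_; -[1+_])
  import Data.Integer.Properties as ℤ
  import Data.Integer.Solver as ℤ
  open import Algebra.Properties.AbelianGroup ℤ.+-0-abelianGroup using (∙-cancelʳ)
  open import Data.Nat
  open import Data.Nat.Properties
  import Data.Nat.Solver as ℕ
  open import Data.Product using (∃-syntax; _×_; _,_; proj₁; proj₂)
  open import Data.Sum using (_⊎_; inj₁; inj₂)
  open import Relation.Binary.PropositionalEquality
  open import Relation.Nullary using (contradiction)

  odd : ℕ → Bool
  odd zero    = false
  odd (suc n) = not (odd n)

  bit : ℤ → Bool
  bit (+ n)    = odd n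
  bit -[1+ n ] = not (odd n)

  half : ℤ → ℤ
  half (+ n)    = + ⌊ n /2⌋
  half -[1+ n ] = -[1+ ⌊ n /2⌋ ]

  -- Reverses the D lowest binary digits of x (in two's complement).
  rev : ℕ → ℤ → ℕ
  rev zero    x = 0
  rev (suc D) x = (if bit x then 2 ^ D else 0) + rev D (half x)

  -- All lengths up to `B` are compared at once: length `K` orders the streams, and the depth of a
  -- round orders its elements.
  _≼[_]_ : ℤ → ℕ → ℤ → Set
  x ≼[ B ] y = ∀ D → D ≤ B → rev D x ≤ rev D y

  digitℕ : Bool → ℕ
  digitℕ b = if b then 1 else 0

  digit : Bool → ℤ
  digit b = + digitℕ b

  not-involutive : ∀ b → not (not b) ≡ b
  not-involutive true  = refl
  not-involutive false = refl

  ⌊n/2⌋-odd : ∀ n → n ≡ ⌊ n /2⌋ + ⌊ n /2⌋ + digitℕ (odd n)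
  ⌊n/2⌋-odd zero          = refl
  ⌊n/2⌋-odd (suc zero)    = refl
  ⌊n/2⌋-odd (suc (suc n)) = begin
    suc (suc n)                                         ≡⟨ cong (λ k → suc (suc k)) (⌊n/2⌋-odd n) ⟩
    2 + (h + h + digitℕ (odd n))                        ≡⟨ solve 2 (λ h b → con 2 :+ (h :+ h :+ b) :=
                                                             (con 1 :+ h) :+ (con 1 :+ h) :+ b) refl h (digitℕ (odd n)) ⟩
    suc h + suc h + digitℕ (odd n)                      ≡⟨ cong (λ b → suc h + suc h + digitℕ b)
                                                             (sym (not-involutive (odd n))) ⟩
    suc h + suc h + digitℕ (not (not (odd n)))          ∎
    where
    open ≡-Reasoning
    open ℕ.+-*-Solver
    h = ⌊ n /2⌋

  half+half+bit : ∀ x → x ≡ half x ℤ.+ half x ℤ.+ digit (bit x)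
  half+half+bit (+ n)    = cong +_ (⌊n/2⌋-odd n)
  half+half+bit -[1+ n ] with odd n | ⌊n/2⌋-odd n
  ... | true  | e = cong -[1+_] (trans e (+-comm (⌊ n /2⌋ + ⌊ n /2⌋) 1))
  ... | false | e = cong -[1+_] (trans e (+-identityʳ (⌊ n /2⌋ + ⌊ n /2⌋)))

  i+i≢1 : ∀ i → i ℤ.+ i ≢ + 1
  i+i≢1 (+ suc (suc n)) ()
  i+i≢1 (+ suc zero)    ()

  i+i-injective : ∀ i j → i ℤ.+ i ≡ j ℤ.+ j → i ≡ j
  i+i-injective i j e = ℤ.*-cancelˡ-≡ (+ 2) i j
    (trans (solve 1 (λ i → con (+ 2) :* i := i :+ i) refl i)
      (trans e (solve 1 (λ i → i :+ i := con (+ 2) :* i) refl j)))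
    where open ℤ.+-*-Solver

  i+i≢j+j+1 : ∀ i j → i ℤ.+ i ≢ j ℤ.+ j ℤ.+ + 1
  i+i≢j+j+1 i j e = i+i≢1 (i ℤ.- j) (trans
    (solve 2 (λ i j → (i :- j) :+ (i :- j) := (i :+ i) :- (j :+ j)) refl i j)
    (trans (cong (ℤ._- (j ℤ.+ j)) e)
      (solve 1 (λ j → (j :+ j :+ con (+ 1)) :- (j :+ j) := con (+ 1)) refl j)))
    where open ℤ.+-*-Solver

  half-bit-unique : ∀ i j b c → i ℤ.+ i ℤ.+ digit b ≡ j ℤ.+ j ℤ.+ digit c → b ≡ c × i ≡ j
  half-bit-unique i j true true e   = refl , i+i-injective i j (∙-cancelʳ _ (i ℤ.+ i) (j ℤ.+ j) e)
  half-bit-unique i j false false e = refl , i+i-injective i j (∙-cancelʳ _ (i ℤ.+ i) (j ℤ.+ j) e)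
  half-bit-unique i j true false e  =
    contradiction (trans (sym (ℤ.+-identityʳ (j ℤ.+ j))) (sym e)) (i+i≢j+j+1 j i)
  half-bit-unique i j false true e  =
    contradiction (trans (sym (ℤ.+-identityʳ (i ℤ.+ i))) e) (i+i≢j+j+1 i j)

  bit-half-≡ : ∀ x q b → x ≡ q ℤ.+ q ℤ.+ digit b → bit x ≡ b × half x ≡ q
  bit-half-≡ x q b e = half-bit-unique (half x) q (bit x) b (trans (sym (half+half+bit x)) e)

  -- The lowest digit of `d` is zero, so no carry occurs and halving commutes with the addition.
  +-even : ∀ x d → bit d ≡ false → bit (x ℤ.+ d) ≡ bit x × half (x ℤ.+ d) ≡ half x ℤ.+ half d
  +-even x d d-even = bit-half-≡ (x ℤ.+ d) (half x ℤ.+ half d) (bit x) (begin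
    x ℤ.+ d
      ≡⟨ cong₂ ℤ._+_ (half+half+bit x) (half+half+bit d) ⟩
    (h ℤ.+ h ℤ.+ digit (bit x)) ℤ.+ (k ℤ.+ k ℤ.+ digit (bit d))
      ≡⟨ cong (λ b → (h ℤ.+ h ℤ.+ digit (bit x)) ℤ.+ (k ℤ.+ k ℤ.+ digit b)) d-even ⟩
    (h ℤ.+ h ℤ.+ digit (bit x)) ℤ.+ (k ℤ.+ k ℤ.+ + 0)
      ≡⟨ solve 3 (λ h k b → (h :+ h :+ b) :+ (k :+ k :+ con (+ 0)) := (h :+ k) :+ (h :+ k) :+ b)
           refl h k (digit (bit x)) ⟩
    (h ℤ.+ k) ℤ.+ (h ℤ.+ k) ℤ.+ digit (bit x) ∎)
    where
    open ≡-Reasoning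
    open ℤ.+-*-Solver
    h = half x
    k = half d

  +-odd : ∀ x d → bit d ≡ true → bit (x ℤ.+ d) ≡ not (bit x)
  +-odd x d d-odd with bit x | half+half+bit x
  ... | true  | e = proj₁ (bit-half-≡ (x ℤ.+ d) (h ℤ.+ k ℤ.+ + 1) false
    (trans (cong₂ ℤ._+_ e (trans (half+half+bit d) (cong (λ b → k ℤ.+ k ℤ.+ digit b) d-odd)))
      (solve 2 (λ h k → (h :+ h :+ con (+ 1)) :+ (k :+ k :+ con (+ 1)) :=
        (h :+ k :+ con (+ 1)) :+ (h :+ k :+ con (+ 1)) :+ con (+ 0)) refl h k)))
    where
    open ℤ.+-*-Solver
    h = half x
    k = half d
  ... | false | e = proj₁ (bit-half-≡ (x ℤ.+ d) (h ℤ.+ k) true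
    (trans (cong₂ ℤ._+_ e (trans (half+half+bit d) (cong (λ b → k ℤ.+ k ℤ.+ digit b) d-odd)))
      (solve 2 (λ h k → (h :+ h :+ con (+ 0)) :+ (k :+ k :+ con (+ 1)) :=
        (h :+ k) :+ (h :+ k) :+ con (+ 1)) refl h k)))
    where
    open ℤ.+-*-Solver
    h = half x
    k = half d

  rev<2^ : ∀ D x → rev D x < 2 ^ D
  rev<2^ zero    x = ≤-refl
  rev<2^ (suc D) x with bit x
  ... | true  = +-monoʳ-< (2 ^ D) (≤-trans (rev<2^ D (half x)) (m≤m+n (2 ^ D) 0))
  ... | false = ≤-trans (rev<2^ D (half x)) (m≤m+n (2 ^ D) (2 ^ D + 0))

  -- The lowest digit becomes the leading one and outweighs all others together.
  rev-bit-< : ∀ D x y → bit x ≡ false → bit y ≡ true → rev (suc D) x < rev (suc D) y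
  rev-bit-< D x y ex ey rewrite ex | ey = ≤-trans (rev<2^ D (half x)) (m≤m+n (2 ^ D) _)

  ≼-bit : ∀ B x y → bit x ≡ false → bit y ≡ true → x ≼[ B ] y
  ≼-bit B x y ex ey zero    _ = ≤-refl
  ≼-bit B x y ex ey (suc D) _ = <⇒≤ (rev-bit-< D x y ex ey)

  ≼-half : ∀ {B x y h k} → bit x ≡ bit y → half x ≡ h → half y ≡ k → h ≼[ B ] k → x ≼[ suc B ] y
  ≼-half ex refl refl le zero    _         = ≤-refl
  ≼-half ex refl refl le (suc D) (s≤s D≤B) rewrite ex = +-monoʳ-≤ _ (le D D≤B)

  Zigzag : ℕ → ℤ → ℤ → ℤ → ℤ → Set
  Zigzag B z₀ z₁ z₂ z₃ =
    (z₀ ≼[ B ] z₁ × z₂ ≼[ B ] z₁ × z₂ ≼[ B ] z₃) ⊎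
    (z₁ ≼[ B ] z₀ × z₁ ≼[ B ] z₂ × z₃ ≼[ B ] z₂)

  zigzag-odd : ∀ B x d → bit d ≡ true → Zigzag B x (x ℤ.+ d) (x ℤ.+ d ℤ.+ d) (x ℤ.+ d ℤ.+ d ℤ.+ d)
  zigzag-odd B x d d-odd = by-digit (bit x) refl
    where
    z₁ = x ℤ.+ d
    z₂ = z₁ ℤ.+ d
    z₃ = z₂ ℤ.+ d
    flip : ∀ z {b} → bit z ≡ b → bit (z ℤ.+ d) ≡ not b
    flip z e = trans (+-odd z d d-odd) (cong not e)
    by-digit : ∀ b → bit x ≡ b → Zigzag B x z₁ z₂ z₃
    by-digit false b₀ = let b₁ = flip x b₀; b₂ = flip z₁ b₁; b₃ = flip z₂ b₂ in
      inj₁ (≼-bit B x z₁ b₀ b₁ , ≼-bit B z₂ z₁ b₂ b₁ , ≼-bit B z₂ z₃ b₂ b₃)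
    by-digit true  b₀ = let b₁ = flip x b₀; b₂ = flip z₁ b₁; b₃ = flip z₂ b₂ in
      inj₂ (≼-bit B z₁ x b₁ b₀ , ≼-bit B z₁ z₂ b₁ b₂ , ≼-bit B z₃ z₂ b₃ b₂)

  -- All four terms share their lowest digit, and their halves form a progression with step
  -- `half d`.
  zigzag-even : ∀ B x d → bit d ≡ false →
    (let h = half x; e = half d in Zigzag B h (h ℤ.+ e) (h ℤ.+ e ℤ.+ e) (h ℤ.+ e ℤ.+ e ℤ.+ e)) →
    Zigzag (suc B) x (x ℤ.+ d) (x ℤ.+ d ℤ.+ d) (x ℤ.+ d ℤ.+ d ℤ.+ d)
  zigzag-even B x d d-even = λ
    { (inj₁ (p , q , r)) → inj₁
        (≼-half (sym b₁) refl h₁ p , ≼-half b₂ h₂ h₁ q , ≼-half (sym b₃) h₂ h₃ r)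
    ; (inj₂ (p , q , r)) → inj₂
        (≼-half b₁ h₁ refl p , ≼-half (sym b₂) h₁ h₂ q , ≼-half b₃ h₃ h₂ r)
    }
    where
    b₁ = proj₁ (+-even x d d-even)
    h₁ = proj₂ (+-even x d d-even)
    b₂ = proj₁ (+-even (x ℤ.+ d) d d-even)
    h₂ = trans (proj₂ (+-even (x ℤ.+ d) d d-even)) (cong (ℤ._+ half d) h₁)
    b₃ = proj₁ (+-even (x ℤ.+ d ℤ.+ d) d d-even)
    h₃ = trans (proj₂ (+-even (x ℤ.+ d ℤ.+ d) d d-even)) (cong (ℤ._+ half d) h₂)

  -- Consecutive terms differ first at the lowest nonzero digit of d, and
  -- this digit alternates along the progression.
  zigzag : ∀ B x d → Zigzag B x (x ℤ.+ d) (x ℤ.+ d ℤ.+ d) (x ℤ.+ d ℤ.+ d ℤ.+ d)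
  zigzag zero    x d = inj₁ ((λ { _ z≤n → ≤-refl }) , (λ { _ z≤n → ≤-refl }) , λ { _ z≤n → ≤-refl })
  zigzag (suc B) x d with bit d in d-bit
  ... | true  = zigzag-odd (suc B) x d d-bit
  ... | false = zigzag-even B x d d-bit (zigzag B (half x) (half d))

  rev-suc-injective : ∀ D x y → rev (suc D) x ≡ rev (suc D) y →
    bit x ≡ bit y × rev D (half x) ≡ rev D (half y)
  rev-suc-injective D x y e with bit x | bit y
  ... | true  | true  = refl , +-cancelˡ-≡ (2 ^ D) _ _ e
  ... | false | false = refl , e
  ... | true  | false = contradiction (sym e) (<⇒≢ (≤-trans (rev<2^ D (half y)) (m≤m+n (2 ^ D) _)))
  ... | false | true  = contradiction e (<⇒≢ (≤-trans (rev<2^ D (half x)) (m≤m+n (2 ^ D) _)))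

  rev-≡⇒≡mod : ∀ D x y → rev D x ≡ rev D y → ∃[ q ] x ≡ y ℤ.+ q ℤ.* + (2 ^ D)
  rev-≡⇒≡mod zero    x y _ = x ℤ.- y , solve 2 (λ x y → x := y :+ (x :- y) :* con (+ 1)) refl x y
    where open ℤ.+-*-Solver
  rev-≡⇒≡mod (suc D) x y e with rev-suc-injective D x y e
  ... | eb , eh with rev-≡⇒≡mod D (half x) (half y) eh
  ...   | q , eq = q , (begin
    x                                            ≡⟨ half+half+bit x ⟩
    half x ℤ.+ half x ℤ.+ digit (bit x)          ≡⟨ cong₂ (λ h b → h ℤ.+ h ℤ.+ digit b) eq eb ⟩
    (k ℤ.+ q ℤ.* t) ℤ.+ (k ℤ.+ q ℤ.* t) ℤ.+ b    ≡⟨ solve 4 (λ k q t b →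
                                                      (k :+ q :* t) :+ (k :+ q :* t) :+ b :=
                                                      (k :+ k :+ b) :+ q :* (con (+ 2) :* t)) refl k q t b ⟩
    (k ℤ.+ k ℤ.+ b) ℤ.+ q ℤ.* (+ 2 ℤ.* t)        ≡⟨ cong₂ (λ y t → y ℤ.+ q ℤ.* t) (sym (half+half+bit y))
                                                      (sym (ℤ.pos-* 2 (2 ^ D))) ⟩
    y ℤ.+ q ℤ.* + (2 ^ suc D)                    ∎)
    where
    open ≡-Reasoning
    open ℤ.+-*-Solver
    k = half y
    b = digit (bit y)
    t = + (2 ^ D)

  multiple<⇒≡ : ∀ {x y q n} → x ≡ y ℤ.+ q ℤ.* + n → ℤ.∣ x ℤ.- y ∣ < n → x ≡ y
  multiple<⇒≡ {x} {y} {q} {n} e lt = ℤ.i-j≡0⇒i≡j x y (ℤ.∣i∣≡0⇒i≡0 zero-diff)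
    where
    open ℤ.+-*-Solver
    diff : ℤ.∣ x ℤ.- y ∣ ≡ ℤ.∣ q ∣ * n
    diff = trans (cong ℤ.∣_∣ (trans (cong (ℤ._- y) e)
        (solve 2 (λ y t → (y :+ t) :- y := t) refl y (q ℤ.* + n))))
      (ℤ.abs-* q (+ n))
    zero-diff : ℤ.∣ x ℤ.- y ∣ ≡ 0
    zero-diff with ℤ.∣ q ∣ | diff
    ... | zero  | e′ = e′
    ... | suc k | e′ = contradiction lt (≤⇒≯ (≤-trans (m≤m+n n (k * n)) (≤-reflexive (sym e′))))

  rev-injective : ∀ D x y → ℤ.∣ x ℤ.- y ∣ < 2 ^ D → rev D x ≡ rev D y → x ≡ y
  rev-injective D x y lt e = let q , eq = rev-≡⇒≡mod D x y e in multiple<⇒≡ {q = q} eq lt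

-- Streams, gaps and rounds.

-- The M = 2 ^ K residues and the two signs give W = 2 M streams.  An integer
-- has scale u when M * 4 ^ (u - 1) ≤ ∣ x ∣ < M * 4 ^ u, and scale 0 when
-- ∣ x ∣ < M.  A stream s has its gaps at the scales s + 1, s + 1 + W, …, and
-- the round of x is the number of gaps of its stream begun up to x.  In the
-- order of key, a round lists its negative elements by decreasing, then its
-- other elements by increasing reversed digits; with the reversed stream
-- numbers for the nonnegative residues, whatever comes later in a round
-- reaches its gap earlier among the elements of the same sign.
module TimeKey (K : ℕ) where

  open BitReversal
  open import Data.Integer as ℤ using (ℤ; +_; -[1+_])
  import Data.Integer.Properties as ℤ
  open import Data.Nat
  open import Data.Nat.DivMod
  open import Data.Nat.Properties
  open import Data.Nat.Solver using (module +-*-Solver)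
  open import Data.Product using (_×_; _,_)
  open import Data.Sum using (_⊎_; inj₁; inj₂)
  open import Relation.Binary using (tri<; tri≈; tri>)
  open import Relation.Binary.PropositionalEquality
  open import Relation.Nullary using (¬_; yes; no; contradiction)

  M W : ℕ
  M = 2 ^ K
  W = 2 * M

  instance
    M≢0 : NonZero M
    M≢0 = m^n≢0 2 K
    W≢0 : NonZero W
    W≢0 = m*n≢0 2 M

  -- The least `u` with `b < 4 ^ u`. It rises by at most one when `b` does, so one comparison
  -- updates it.
  level : ℕ → ℕ
  level zero    = 0
  level (suc b) with suc b <? 4 ^ level b
  ... | yes _ = level b
  ... | no  _ = suc (level b)

  <4^level : ∀ b → b < 4 ^ level b
  <4^level zero    = ≤-refl
  <4^level (suc b) with suc b <? 4 ^ level b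
  ... | yes p = p
  ... | no  _ = ≤-<-trans (<4^level b) (^-monoʳ-< 4 (s≤s (s≤s z≤n)) (n<1+n (level b)))

  4^level≤ : ∀ b {k} → level b ≡ suc k → 4 ^ k ≤ b
  4^level≤ (suc b) e with suc b <? 4 ^ level b
  4^level≤ (suc b) e    | yes _ = m≤n⇒m≤1+n (4^level≤ b e)
  4^level≤ (suc b) refl | no ¬p = ≮⇒≥ ¬p

  scale : ℤ → ℕ
  scale x = level (ℤ.∣ x ∣ / M)

  stream : ℤ → ℕ
  stream x@(+ n)      = M + (M ∸ suc (rev K x))
  stream x@(-[1+ n ]) = rev K x

  -- The offset moves the gap scales `s + 1 + j W` of each stream `s` to the multiples `(j + 1) W`,
  -- so that the quotient by `W` counts gaps.
  phase : ℤ → ℕ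
  phase x = scale x + (W ∸ suc (stream x))

  round : ℤ → ℕ
  round x = phase x / W

  -- The first condition excludes the stream `W - 1` at scale 0, whose phase is 0 although its first
  -- gap is at scale `W`.
  Gap : ℤ → Set
  Gap x = 0 < scale x × phase x % W ≡ 0

  W≡M+M : W ≡ M + M
  W≡M+M = cong (_+_ M) (+-identityʳ M)

  stream<W : ∀ x → stream x < W
  stream<W x@(+ n)      = subst (stream x <_) (sym W≡M+M)
    (+-monoʳ-< M (≤-trans (≤-reflexive (sym (+-∸-assoc 1 (rev<2^ K x)))) (m∸n≤m M (rev K x))))
  stream<W x@(-[1+ n ]) = ≤-trans (rev<2^ K x) (m≤m+n M _)

  phase+stream : ∀ x → phase x + suc (stream x) ≡ scale x + W
  phase+stream x = trans (+-assoc (scale x) _ _) (cong (_+_ (scale x)) (m∸n+n≡m (stream<W x)))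

  phase-divMod : ∀ x → phase x ≡ phase x % W + round x * W
  phase-divMod x = m≡m%n+[m/n]*n (phase x) W

  -- The remainder of the phase is at most `W - 1`, so a round stops at the scale just before the
  -- next gap of the stream.
  scale≤ : ∀ x → scale x ≤ stream x + round x * W
  scale≤ x = +-cancelʳ-≤ W _ _ (begin
    scale x + W                               ≡⟨ sym (phase+stream x) ⟩
    phase x + suc (stream x)                  ≡⟨ cong (_+ suc (stream x)) (phase-divMod x) ⟩
    phase x % W + round x * W + suc (stream x) ≡⟨ solve 3 (λ r q s → r :+ q :+ (con 1 :+ s) :=
                                                   s :+ q :+ (con 1 :+ r)) refl (phase x % W) (round x * W) (stream x) ⟩
    stream x + round x * W + suc (phase x % W) ≤⟨ +-monoʳ-≤ (stream x + round x * W) (m%n<n (phase x) W) ⟩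
    stream x + round x * W + W                ∎)
    where
    open ≤-Reasoning
    open +-*-Solver

  -- A round after round 0 begins with its gap, at scale `stream y + 1 + (round y - 1) W`; elements
  -- outside the gap lie at least one scale higher. The `W` on the right avoids subtraction.
  scale≥ : ∀ y → ¬ Gap y → 0 < round y → 2 + stream y + round y * W ≤ scale y + W
  scale≥ y ¬gap 0<round = begin
    2 + stream y + round y * W                 ≡⟨ solve 2 (λ s q → con 2 :+ s :+ q :=
                                                   con 1 :+ q :+ (con 1 :+ s)) refl (stream y) (round y * W) ⟩
    1 + round y * W + suc (stream y)           ≤⟨ +-monoˡ-≤ (suc (stream y)) (+-monoˡ-≤ (round y * W) 0<r) ⟩
    phase y % W + round y * W + suc (stream y) ≡⟨ cong (_+ suc (stream y)) (sym (phase-divMod y)) ⟩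
    phase y + suc (stream y)                   ≡⟨ phase+stream y ⟩
    scale y + W                                ∎
    where
    open ≤-Reasoning
    open +-*-Solver
    -- A positive round forces a positive scale, so a zero remainder would put `y` into a gap.
    W<scale+W : W < scale y + W
    W<scale+W = begin-strict
      W                            ≡⟨ sym (*-identityˡ W) ⟩
      1 * W                        ≤⟨ *-monoˡ-≤ W 0<round ⟩
      round y * W                  ≤⟨ m≤n+m (round y * W) (phase y % W) ⟩
      phase y % W + round y * W    ≡⟨ sym (phase-divMod y) ⟩
      phase y                      <⟨ m<m+n (phase y) (s≤s z≤n) ⟩
      phase y + suc (stream y)     ≡⟨ phase+stream y ⟩
      scale y + W                  ∎
    0<r : 0 < phase y % W
    0<r = n≢0⇒n>0 λ r≡0 → ¬gap (+-cancelʳ-< W 0 (scale y) W<scale+W , r≡0)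

  -- Between two such scales lies one full scale, whose ends differ by the factor 4.
  4*abs≤ : ∀ x y → 2 + scale x ≤ scale y → 4 * ℤ.∣ x ∣ ≤ ℤ.∣ y ∣
  4*abs≤ x y le with scale y in ey
  4*abs≤ x y (s≤s le) | suc k = begin
    4 * a                       ≤⟨ *-monoʳ-≤ 4 (<⇒≤ (m<n*[1+m/n] a)) ⟩
    4 * (M * suc (a / M))       ≤⟨ *-monoʳ-≤ 4 (*-monoʳ-≤ M (<4^level (a / M))) ⟩
    4 * (M * 4 ^ scale x)       ≡⟨ solve 2 (λ m p → con 4 :* (m :* p) := con 4 :* p :* m) refl M (4 ^ scale x) ⟩
    4 ^ suc (scale x) * M       ≤⟨ *-monoˡ-≤ M (^-monoʳ-≤ 4 le) ⟩
    4 ^ k * M                   ≤⟨ *-monoˡ-≤ M (4^level≤ (ℤ.∣ y ∣ / M) ey) ⟩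
    (ℤ.∣ y ∣ / M) * M           ≤⟨ m/n*n≤m ℤ.∣ y ∣ M ⟩
    ℤ.∣ y ∣                     ∎
    where
    open ≤-Reasoning
    open +-*-Solver
    a = ℤ.∣ x ∣
    m<n*[1+m/n] : ∀ m → m < M * suc (m / M)
    m<n*[1+m/n] m = begin-strict
      m                      ≡⟨ m≡m%n+[m/n]*n m M ⟩
      m % M + m / M * M      <⟨ +-monoˡ-< (m / M * M) (m%n<n m M) ⟩
      suc (m / M) * M        ≡⟨ *-comm (suc (m / M)) M ⟩
      M * suc (m / M)        ∎

  -- The blocks of a stream end at the scales stream + round * W.
  separated : ∀ x y → ¬ Gap y → W + (stream x + round x * W) ≤ stream y + round y * W → 4 * ℤ.∣ x ∣ ≤ ℤ.∣ y ∣
  separated x y ¬gap le = 4*abs≤ x y (+-cancelʳ-≤ W _ _ (begin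
    2 + scale x + W                    ≤⟨ +-monoˡ-≤ W (+-monoʳ-≤ 2 (scale≤ x)) ⟩
    2 + (stream x + round x * W) + W   ≡⟨ solve 2 (λ a w → con 2 :+ a :+ w := con 2 :+ (w :+ a)) refl
                                            (stream x + round x * W) W ⟩
    2 + (W + (stream x + round x * W)) ≤⟨ +-monoʳ-≤ 2 le ⟩
    2 + stream y + round y * W         ≤⟨ scale≥ y ¬gap 0<round ⟩
    scale y + W                        ∎))
    where
    open ≤-Reasoning
    open +-*-Solver
    0<round : 0 < round y
    0<round = n≢0⇒n>0 λ e → contradiction (stream<W y) (≤⇒≯ (begin
      W                                ≤⟨ m≤m+n W _ ⟩
      W + (stream x + round x * W)     ≤⟨ le ⟩
      stream y + round y * W           ≡⟨ cong (λ n → stream y + n * W) e ⟩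
      stream y + 0                     ≡⟨ +-identityʳ (stream y) ⟩
      stream y                         ∎))

  -- The order of listing.

  -- Scales in round `n` are at most `(n + 1) W`, so absolute values there stay below
  -- `2 ^ K * 4 ^ ((n + 1) W) = H n`, and `depth n` digits tell elements of equal sign apart.
  depth : ℕ → ℕ
  depth n = K + 2 * (suc n * W)

  H : ℕ → ℕ
  H n = 2 ^ depth n

  -- Round `n` uses the keys in `[2 H n, 4 H n)`: the lower half counts down for negative elements,
  -- the upper half counts up for the others. The ranges of different rounds are disjoint.
  key : ℤ → ℕ
  key x@(+ n)      = 3 * H (round x) + rev (depth (round x)) x
  key x@(-[1+ n ]) = 3 * H (round x) ∸ suc (rev (depth (round x)) x)

  abs<H : ∀ x → ℤ.∣ x ∣ < H (round x)
  abs<H x = begin-strict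
    a                                ≡⟨ m≡m%n+[m/n]*n a M ⟩
    a % M + a / M * M                <⟨ +-monoˡ-< (a / M * M) (m%n<n a M) ⟩
    suc (a / M) * M                  ≤⟨ *-monoˡ-≤ M (<4^level (a / M)) ⟩
    4 ^ scale x * M                  ≤⟨ *-monoˡ-≤ M (^-monoʳ-≤ 4 scale≤′) ⟩
    4 ^ (suc (round x) * W) * M      ≡⟨ cong (_* M) (^-*-assoc 2 2 (suc (round x) * W)) ⟩
    2 ^ (2 * (suc (round x) * W)) * M ≡⟨ *-comm _ M ⟩
    M * 2 ^ (2 * (suc (round x) * W)) ≡⟨ sym (^-distribˡ-+-* 2 K (2 * (suc (round x) * W))) ⟩
    H (round x)                      ∎
    where
    open ≤-Reasoning
    a = ℤ.∣ x ∣
    scale≤′ : scale x ≤ suc (round x) * W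
    scale≤′ = ≤-trans (scale≤ x) (+-monoˡ-≤ (round x * W) (<⇒≤ (stream<W x)))

  2H≤key : ∀ x → 2 * H (round x) ≤ key x
  2H≤key x@(+ n)      = ≤-trans (*-monoˡ-≤ (H (round x)) (n≤1+n 2)) (m≤m+n (3 * H (round x)) _)
  2H≤key x@(-[1+ n ]) = m+n≤o⇒m≤o∸n (2 * H (round x)) {suc (rev (depth (round x)) x)} (begin
    2 * h + suc (rev (depth (round x)) x) ≤⟨ +-monoʳ-≤ (2 * h) (rev<2^ (depth (round x)) x) ⟩
    2 * h + h                             ≡⟨ +-comm (2 * h) h ⟩
    3 * h                                 ∎)
    where
    open ≤-Reasoning
    h = H (round x)

  key<4H : ∀ x → key x < 4 * H (round x)
  key<4H x@(+ n)      = begin-strict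
    3 * h + rev (depth (round x)) x <⟨ +-monoʳ-< (3 * h) (rev<2^ (depth (round x)) x) ⟩
    3 * h + h                       ≡⟨ +-comm (3 * h) h ⟩
    4 * h                           ∎
    where
    open ≤-Reasoning
    h = H (round x)
  key<4H x@(-[1+ n ]) = begin-strict
    3 * h ∸ suc (rev (depth (round x)) x) ≤⟨ m∸n≤m (3 * h) (suc (rev (depth (round x)) x)) ⟩
    3 * h                                 <⟨ m<n+m (3 * h) (m^n>0 2 (depth (round x))) ⟩
    4 * h                                 ∎
    where
    open ≤-Reasoning
    h = H (round x)

  depth-mono : ∀ {m n} → m ≤ n → depth m ≤ depth n
  depth-mono m≤n = +-monoʳ-≤ K (*-monoʳ-≤ 2 (*-monoˡ-≤ W (s≤s m≤n)))

  4H≤2H : ∀ {m n} → m < n → 4 * H m ≤ 2 * H n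
  4H≤2H {m} {n} m<n = begin
    4 * H m           ≡⟨ *-assoc 2 2 (H m) ⟩
    2 * 2 ^ suc (depth m) ≤⟨ *-monoʳ-≤ 2 (^-monoʳ-≤ 2 (+-monoʳ-< K (*-monoʳ-< 2 (*-monoˡ-< W (s≤s m<n))))) ⟩
    2 * H n           ∎
    where open ≤-Reasoning

  abs≤key : ∀ x → ℤ.∣ x ∣ ≤ key x
  abs≤key x = ≤-trans (<⇒≤ (abs<H x)) (≤-trans (m≤m+n (H (round x)) _) (2H≤key x))

  round<⇒key< : ∀ x y → round x < round y → key x < key y
  round<⇒key< x y lt = <-≤-trans (key<4H x) (≤-trans (4H≤2H lt) (2H≤key y))

  key<⇒round≤ : ∀ x y → key x < key y → round x ≤ round y
  key<⇒round≤ x y lt = ≮⇒≥ λ gt → <-asym lt (round<⇒key< y x gt)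

  key-+-< : ∀ m n → round (+ m) ≡ round (+ n) → key (+ m) < key (+ n) →
    rev (depth (round (+ m))) (+ m) < rev (depth (round (+ m))) (+ n)
  key-+-< m n e lt rewrite e = +-cancelˡ-< (3 * H (round (+ n))) _ _ lt

  key-neg-< : ∀ m n → round -[1+ m ] ≡ round -[1+ n ] → key -[1+ m ] < key -[1+ n ] →
    rev (depth (round -[1+ m ])) -[1+ n ] < rev (depth (round -[1+ m ])) -[1+ m ]
  key-neg-< m n e lt rewrite e = ≮⇒≥ λ gt → contradiction
    (∸-monoʳ-≤ (3 * H (round -[1+ n ])) gt) (<⇒≱ lt)

  key-neg<key-+ : ∀ m n → round -[1+ m ] ≡ round (+ n) → key -[1+ m ] < key (+ n)
  key-neg<key-+ m n e rewrite e = <-≤-trans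
    (∸-monoʳ-< {3 * H (round (+ n))} z<s (≤-trans (rev<2^ (depth (round (+ n))) -[1+ m ]) (m≤m+n _ _)))
    (m≤m+n (3 * H (round (+ n))) _)

  next-round : ∀ x y → ¬ Gap y → round x < round y → stream x ≤ stream y → 4 * ℤ.∣ x ∣ ≤ ℤ.∣ y ∣
  next-round x y ¬gap r< s≤ = separated x y ¬gap (begin
    W + (stream x + round x * W)  ≡⟨ solve 3 (λ w s q → w :+ (s :+ q) := s :+ (w :+ q)) refl W (stream x) (round x * W) ⟩
    stream x + suc (round x) * W  ≤⟨ +-mono-≤ s≤ (*-monoˡ-≤ W r<) ⟩
    stream y + round y * W        ∎)
    where
    open ≤-Reasoning
    open +-*-Solver

  -- Within a round the keys of nonnegative elements increase with the reversed digits, so the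
  -- rounds must differ. At length `K` the same comparison, through the reversed stream numbers,
  -- puts the stream of `m` not after that of `n`.
  ++-separated : ∀ {B} m n → ¬ Gap (+ n) → key (+ m) < key (+ n) → depth (round (+ m)) ≤ B →
    (+ n) ≼[ B ] (+ m) → round (+ m) < round (+ n) × 4 * m ≤ n
  ++-separated m n ¬gap lt D≤B n≼m =
    r< , next-round (+ m) (+ n) ¬gap r< (+-monoʳ-≤ M (∸-monoʳ-≤ M (s≤s (n≼m K (≤-trans (m≤m+n K _) D≤B)))))
    where
    r< = ≤∧≢⇒< (key<⇒round≤ (+ m) (+ n) lt) λ e → contradiction (n≼m _ D≤B) (<⇒≱ (key-+-< m n e lt))

  -- The mirror image: keys of negative elements decrease with the reversed digits, and their stream
  -- numbers are not reversed.
  neg-neg-separated : ∀ {B} m n → ¬ Gap -[1+ n ] → key -[1+ m ] < key -[1+ n ] → depth (round -[1+ m ]) ≤ B →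
    -[1+ m ] ≼[ B ] -[1+ n ] → round -[1+ m ] < round -[1+ n ] × 4 * suc m ≤ suc n
  neg-neg-separated m n ¬gap lt D≤B m≼n =
    r< , next-round -[1+ m ] -[1+ n ] ¬gap r< (m≼n K (≤-trans (m≤m+n K _) D≤B))
    where
    r< = ≤∧≢⇒< (key<⇒round≤ -[1+ m ] -[1+ n ] lt) λ e → contradiction (m≼n _ D≤B) (<⇒≱ (key-neg-< m n e lt))

  -- Negative streams are numbered below the others, so any later round gives the jump.
  neg-+-separated : ∀ m n → ¬ Gap (+ n) → key -[1+ m ] < key (+ n) →
    round (+ n) ≡ round -[1+ m ] ⊎ 4 * suc m ≤ n
  neg-+-separated m n ¬gap lt with <-cmp (round -[1+ m ]) (round (+ n))
  ... | tri≈ _ e _  = inj₁ (sym e)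
  ... | tri> _ _ gt = contradiction (key<⇒round≤ -[1+ m ] (+ n) lt) (<⇒≱ gt)
  ... | tri< r< _ _ = inj₂ (next-round -[1+ m ] (+ n) ¬gap r< (≤-trans (<⇒≤ (rev<2^ K -[1+ m ])) (m≤m+n M _)))

  -- Negative elements open a round, so the round must be later. Moving back to a smaller stream
  -- number costs less than `W`, which a second round makes up for.
  +-neg-separated : ∀ m n → ¬ Gap -[1+ n ] → key (+ m) < key -[1+ n ] →
    round -[1+ n ] ≡ suc (round (+ m)) ⊎ 4 * m ≤ suc n
  +-neg-separated m n ¬gap lt with <-cmp (suc (round (+ m))) (round -[1+ n ])
  ... | tri≈ _ e _  = inj₁ (sym e)
  ... | tri> _ _ gt = contradiction (≤-antisym (s≤s⁻¹ gt) (key<⇒round≤ (+ m) -[1+ n ] lt))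
                        λ e → <-asym lt (key-neg<key-+ n m e)
  ... | tri< r< _ _ = inj₂ (separated (+ m) -[1+ n ] ¬gap (begin
    W + (stream (+ m) + round (+ m) * W)      ≤⟨ +-monoʳ-≤ W (+-monoˡ-≤ (round (+ m) * W) (<⇒≤ (stream<W (+ m)))) ⟩
    suc (suc (round (+ m))) * W               ≤⟨ *-monoˡ-≤ W r< ⟩
    round -[1+ n ] * W                        ≤⟨ m≤n+m _ (stream -[1+ n ]) ⟩
    stream -[1+ n ] + round -[1+ n ] * W      ∎))
    where open ≤-Reasoning

  key≡⇒round≡ : ∀ x y → key x ≡ key y → round x ≡ round y
  key≡⇒round≡ x y e with <-cmp (round x) (round y)
  ... | tri≈ _ r _  = r
  ... | tri< lt _ _ = contradiction e (<⇒≢ (round<⇒key< x y lt))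
  ... | tri> _ _ gt = contradiction (sym e) (<⇒≢ (round<⇒key< y x gt))

  ∣m⊖n∣<o : ∀ {m n o} → m < o → n < o → ℤ.∣ m ℤ.⊖ n ∣ < o
  ∣m⊖n∣<o {m} {n} m<o n<o = ≤-<-trans (ℤ.∣m⊝n∣≤m⊔n m n) (⊔-lub m<o n<o)

  key-injective : ∀ x y → key x ≡ key y → x ≡ y
  key-injective x@(+ m) y@(+ n) e = rev-injective D x y
    (subst (λ i → ℤ.∣ i ∣ < 2 ^ D) (sym (ℤ.m-n≡m⊖n m n)) (∣m⊖n∣<o (abs<H x) (subst (λ r → n < H r) (sym r) (abs<H y))))
    (+-cancelˡ-≡ (3 * H (round x)) _ _
      (trans e (cong (λ r → 3 * H r + rev (depth r) y) (sym r))))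
    where
    r = key≡⇒round≡ x y e
    D = depth (round x)
  key-injective x@(-[1+ m ]) y@(-[1+ n ]) e = rev-injective D x y
    (∣m⊖n∣<o (subst (λ r → suc n < H r) (sym r) (abs<H y)) (abs<H x))
    (suc-injective (∸-cancelˡ-≡ (bound x) (bound y)
      (trans e (cong (λ r → 3 * H r ∸ suc (rev (depth r) y)) (sym r)))))
    where
    r = key≡⇒round≡ x y e
    D = depth (round x)
    bound : ∀ z → suc (rev D z) ≤ 3 * 2 ^ D
    bound z = ≤-trans (rev<2^ D z) (m≤m+n _ _)
  key-injective x@(+ m) y@(-[1+ n ]) e =
    contradiction (sym e) (<⇒≢ (key-neg<key-+ n m (sym (key≡⇒round≡ x y e))))
  key-injective x@(-[1+ m ]) y@(+ n) e =
    contradiction e (<⇒≢ (key-neg<key-+ m n (key≡⇒round≡ x y e)))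

-- Linear relations among the absolute values of consecutive terms.

module ThreeTermRelations where

  open import Data.Integer as ℤ using (ℤ; +_; -[1+_])
  import Data.Integer.Properties as ℤ
  import Data.Integer.Solver as ℤ
  open import Data.Nat
  open import Data.Nat.Properties
  open import Data.Nat.Solver using (module +-*-Solver)
  open import Relation.Binary.PropositionalEquality
  open +-*-Solver

  neg-sum : ∀ {i j k} → ℤ.- i ℤ.+ j ≡ k → j ≡ k ℤ.+ i
  neg-sum {i} {j} refl = solve′ 2 (λ i j → j :=′ (:-′ i :+′ j) :+′ i) refl i j
    where open ℤ.+-*-Solver renaming (solve to solve′; _:+_ to _:+′_; _:=_ to _:=′_; :-_ to :-′_)

  relation-neg-+-+ : ∀ a b c → -[1+ a ] ℤ.+ + c ≡ + b ℤ.+ + b → c ≡ b + b + suc a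
  relation-neg-+-+ a b c e = ℤ.+-injective (neg-sum {+ suc a} e)

  relation-+-+-neg : ∀ a b c → + a ℤ.+ -[1+ c ] ≡ + b ℤ.+ + b → a ≡ b + b + suc c
  relation-+-+-neg a b c e = relation-neg-+-+ c b a (trans (ℤ.+-comm -[1+ c ] (+ a)) e)

  relation-+-neg-neg : ∀ a b c → + a ℤ.+ -[1+ c ] ≡ -[1+ b ] ℤ.+ -[1+ b ] → suc c ≡ suc b + suc b + a
  relation-+-neg-neg a b c e = ℤ.+-injective (trans
    (solve′ 2 (λ a c → c :=′ :-′ (a :+′ :-′ c) :+′ a) refl (+ a) (+ suc c))
    (trans (cong (λ i → ℤ.- i ℤ.+ + a) e)
      (cong (λ n → + (suc n + a)) (sym (+-suc b b)))))
    where open ℤ.+-*-Solver renaming (solve to solve′; _:+_ to _:+′_; _:=_ to _:=′_; :-_ to :-′_)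

  relation-neg-neg-+ : ∀ a b c → -[1+ a ] ℤ.+ + c ≡ -[1+ b ] ℤ.+ -[1+ b ] → suc a ≡ suc b + suc b + c
  relation-neg-neg-+ a b c e = relation-+-neg-neg c b a (trans (ℤ.+-comm (+ c) -[1+ a ]) e)

  relation-neg-neg-neg : ∀ a b c → -[1+ a ] ℤ.+ -[1+ c ] ≡ -[1+ b ] ℤ.+ -[1+ b ] → suc a + suc c ≡ suc b + suc b
  relation-neg-neg-neg a b c e = cong suc (trans (+-suc a c)
    (trans (ℤ.-[1+-injective e) (sym (+-suc b b))))

  -- Reduces each impossibility below to one linear identity: the given relations are added with
  -- multipliers, and what is left over must vanish.
  excess : ∀ {l r k} → l ≤ r → l ≡ r + k → k ≡ 0
  excess {l} {r} {k} l≤r refl = n≤0⇒n≡0 (+-cancelˡ-≤ r k 0 (≤-trans l≤r (≤-reflexive (sym (+-identityʳ r)))))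

  -- Here `4 b ≤ c ≤ 2 b`.
  middle-small : ∀ a b c → 4 * b ≤ c → a + c ≡ b + b → b + b + a ≡ 0
  middle-small a b c h e = excess (+-mono-≤ h (≤-reflexive e))
    (solve 3 (λ a b c → con 4 :* b :+ (a :+ c) := (c :+ (b :+ b)) :+ (b :+ b :+ a)) refl a b c)

  first-small : ∀ a b c → 4 * a ≤ b → a ≡ b + b + c → 7 * b + 4 * c ≡ 0
  first-small a b c h e = excess (+-mono-≤ h (*-monoʳ-≤ 4 (≤-reflexive (sym e))))
    (solve 3 (λ a b c → con 4 :* a :+ con 4 :* (b :+ b :+ c) :=
      (b :+ con 4 :* a) :+ (con 7 :* b :+ con 4 :* c)) refl a b c)

  -- The second equation gives `2 c ≤ b`, so the first gives `3 b ≤ 2 a`, against `4 a ≤ b`.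
  first-small′ : ∀ a b c e → 4 * a ≤ b → a + c ≡ b + b → b ≡ c + c + e → 5 * b + 2 * e ≡ 0
  first-small′ a b c e h e₁ e₂ = excess
    (+-mono-≤ h (+-mono-≤ (*-monoʳ-≤ 4 (≤-reflexive (sym e₁))) (*-monoʳ-≤ 2 (≤-reflexive (sym e₂)))))
    (solve 4 (λ a b c e → con 4 :* a :+ (con 4 :* (b :+ b) :+ con 2 :* (c :+ c :+ e)) :=
      (b :+ (con 4 :* (a :+ c) :+ con 2 :* b)) :+ (con 5 :* b :+ con 2 :* e)) refl a b c e)

  -- `a` stands for a term of opposite sign before `b` and `c`; the jump from `b` to `c` forces
  -- `2 b ≤ a`.
  opposite-vs-middle : ∀ a b c → 4 * b ≤ c → c ≡ b + b + a → 4 * a ≤ b → b + 3 * a ≡ 0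
  opposite-vs-middle a b c h e h′ = excess (+-mono-≤ h (+-mono-≤ (≤-reflexive e) h′))
    (solve 3 (λ a b c → con 4 :* b :+ (c :+ con 4 :* a) :=
      (c :+ ((b :+ b :+ a) :+ b)) :+ (b :+ con 3 :* a)) refl a b c)

  opposite-vs-last : ∀ a b c → 4 * b ≤ c → c ≡ b + b + a → 4 * a ≤ c → b + b + a ≡ 0
  opposite-vs-last a b c h e h′ = excess
    (+-mono-≤ (*-monoʳ-≤ 2 h) (+-mono-≤ (*-monoʳ-≤ 3 (≤-reflexive e)) h′))
    (solve 3 (λ a b c → con 2 :* (con 4 :* b) :+ (con 3 :* c :+ con 4 :* a) :=
      (con 2 :* c :+ (con 3 :* (b :+ b :+ a) :+ c)) :+ (b :+ b :+ a)) refl a b c)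

  both-far : ∀ a b c e → c ≡ b + b + a → b ≡ c + c + e → b + c + (a + e) ≡ 0
  both-far a b c e e₁ e₂ = excess (+-mono-≤ (≤-reflexive (sym e₁)) (≤-reflexive (sym e₂)))
    (solve 4 (λ a b c e → (b :+ b :+ a) :+ (c :+ c :+ e) := (c :+ b) :+ (b :+ c :+ (a :+ e))) refl a b c e)

-- Impossible sign patterns of monotone progressions.

module MonotoneProgressions (K : ℕ) where

  open BitReversal
  open TimeKey K
  open ThreeTermRelations
  open import Data.Empty using (⊥)
  open import Data.Integer as ℤ using (ℤ; +_; -[1+_])
  import Data.Integer.Properties as ℤ
  import Data.Integer.Solver as ℤ
  open import Data.Nat
  open import Data.Nat.Properties
  open import Data.Product using (_,_; proj₂)
  open import Data.Sum using (_⊎_; inj₁; inj₂)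
  open import Relation.Binary.PropositionalEquality
  open import Relation.Nullary using (¬_; contradiction)

  -- For two terms of one sign in rounds `r < s` after a term of the other sign: `t` is the only
  -- round where either can come without a jump from that term, and they cannot both be in it.
  same-round-⊥ : ∀ {A B : Set} {r s t} → r < s → r ≡ t ⊎ A → s ≡ t ⊎ B → (A → ⊥) → (B → ⊥) → ⊥
  same-round-⊥ r<s (inj₁ refl) (inj₁ refl) _ _ = <-irrefl refl r<s
  same-round-⊥ r<s (inj₂ a)    _           f _ = f a
  same-round-⊥ r<s _           (inj₂ b)    _ g = g b

  key<⇒≢ : ∀ {x y} → key x < key y → x ≢ y
  key<⇒≢ lt refl = <-irrefl refl lt

  -- Sign by sign, one step from a term to a smaller or equal one (for ≼)
  -- forces a magnitude jump by a factor 4 that the progression cannot make.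
  no-monotone-zigzag : ∀ B z₀ z₁ z₂ z₃ → Zigzag B z₀ z₁ z₂ z₃ →
    z₀ ℤ.+ z₂ ≡ z₁ ℤ.+ z₁ → z₁ ℤ.+ z₃ ≡ z₂ ℤ.+ z₂ →
    ¬ Gap z₁ → ¬ Gap z₂ → ¬ Gap z₃ →
    key z₀ < key z₁ → key z₁ < key z₂ → key z₂ < key z₃ → depth (round z₃) ≤ B → ⊥
  no-monotone-zigzag B z₀ z₁ z₂ z₃ zz e₁ e₂ g₁ g₂ g₃ k₁ k₂ k₃ D₃ =
    by-signs z₀ z₁ z₂ z₃ zz e₁ e₂ g₁ g₂ g₃ k₁ k₂ k₃ D₀ D₁ D₂
    where
    D₂ = ≤-trans (depth-mono (key<⇒round≤ z₂ z₃ k₃)) D₃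
    D₁ = ≤-trans (depth-mono (key<⇒round≤ z₁ z₂ k₂)) D₂
    D₀ = ≤-trans (depth-mono (key<⇒round≤ z₀ z₁ k₁)) D₁
    by-signs : ∀ z₀ z₁ z₂ z₃ → Zigzag B z₀ z₁ z₂ z₃ →
      z₀ ℤ.+ z₂ ≡ z₁ ℤ.+ z₁ → z₁ ℤ.+ z₃ ≡ z₂ ℤ.+ z₂ →
      ¬ Gap z₁ → ¬ Gap z₂ → ¬ Gap z₃ →
      key z₀ < key z₁ → key z₁ < key z₂ → key z₂ < key z₃ →
      depth (round z₀) ≤ B → depth (round z₁) ≤ B → depth (round z₂) ≤ B → ⊥
    by-signs (+ a) (+ b) (+ c) (+ e) (inj₁ (_ , z₂≼z₁ , _)) e₁ e₂ g₁ g₂ g₃ k₁ k₂ k₃ D₀ D₁ D₂ =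
      let b+b+a≡0 = middle-small a b c (proj₂ (++-separated b c g₂ k₂ D₁ z₂≼z₁)) (ℤ.+-injective e₁) in
      key<⇒≢ k₁ (cong +_ (trans (m+n≡0⇒n≡0 (b + b) b+b+a≡0)
      (sym (m+n≡0⇒m≡0 b (m+n≡0⇒m≡0 (b + b) b+b+a≡0)))))
    by-signs (+ a) (+ b) (+ c) (+ e) (inj₂ (_ , _ , z₃≼z₂)) e₁ e₂ g₁ g₂ g₃ k₁ k₂ k₃ D₀ D₁ D₂ =
      let c+c+b≡0 = middle-small b c e (proj₂ (++-separated c e g₃ k₃ D₂ z₃≼z₂)) (ℤ.+-injective e₂) in
      key<⇒≢ k₂ (cong +_ (trans (m+n≡0⇒n≡0 (c + c) c+c+b≡0)
      (sym (m+n≡0⇒m≡0 c (m+n≡0⇒m≡0 (c + c) c+c+b≡0)))))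
    by-signs -[1+ a ] -[1+ b ] -[1+ c ] -[1+ e ] (inj₁ (_ , _ , z₂≼z₃)) e₁ e₂ g₁ g₂ g₃ k₁ k₂ k₃ D₀ D₁ D₂ =
      contradiction (middle-small (suc b) (suc c) (suc e) (proj₂ (neg-neg-separated c e g₃ k₃ D₂ z₂≼z₃))
        (relation-neg-neg-neg b c e e₂)) λ ()
    by-signs -[1+ a ] -[1+ b ] -[1+ c ] -[1+ e ] (inj₂ (_ , z₁≼z₂ , _)) e₁ e₂ g₁ g₂ g₃ k₁ k₂ k₃ D₀ D₁ D₂ =
      contradiction (middle-small (suc a) (suc b) (suc c) (proj₂ (neg-neg-separated b c g₂ k₂ D₁ z₁≼z₂))
        (relation-neg-neg-neg a b c e₁)) λ ()
    -- The jump `4 b ≤ c` alone is possible when `a` is large. But `b` and `c` lie in different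
    -- rounds, so one of them also jumps relative to `z₀`.
    by-signs -[1+ a ] (+ b) (+ c) (+ e) (inj₁ (_ , z₂≼z₁ , _)) e₁ e₂ g₁ g₂ g₃ k₁ k₂ k₃ D₀ D₁ D₂ =
      let r< , 4b≤c = ++-separated b c g₂ k₂ D₁ z₂≼z₁
          far = relation-neg-+-+ a b c e₁ in
      same-round-⊥ r<
      (neg-+-separated a b g₁ k₁) (neg-+-separated a c g₂ (<-trans k₁ k₂))
      (λ h → contradiction (m+n≡0⇒n≡0 b (opposite-vs-middle (suc a) b c 4b≤c far h)) λ ())
      (λ h → contradiction (m+n≡0⇒n≡0 (b + b) (opposite-vs-last (suc a) b c 4b≤c far h)) λ ())
    by-signs -[1+ a ] (+ b) (+ c) (+ e) (inj₂ (_ , _ , z₃≼z₂)) e₁ e₂ g₁ g₂ g₃ k₁ k₂ k₃ D₀ D₁ D₂ =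
      contradiction (trans (sym (relation-neg-+-+ a b c e₁)) (m+n≡0⇒m≡0 c (m+n≡0⇒m≡0 (c + c)
        (middle-small b c e (proj₂ (++-separated c e g₃ k₃ D₂ z₃≼z₂)) (ℤ.+-injective e₂)))))
        (λ z → contradiction (m+n≡0⇒n≡0 (b + b) z) λ ())
    by-signs -[1+ a ] -[1+ b ] (+ c) (+ e) (inj₁ (z₀≼z₁ , _ , _)) e₁ e₂ g₁ g₂ g₃ k₁ k₂ k₃ D₀ D₁ D₂ =
      contradiction (first-small (suc a) (suc b) c (proj₂ (neg-neg-separated a b g₁ k₁ D₀ z₀≼z₁))
        (relation-neg-neg-+ a b c e₁)) λ ()
    by-signs -[1+ a ] -[1+ b ] (+ c) (+ e) (inj₂ (_ , _ , z₃≼z₂)) e₁ e₂ g₁ g₂ g₃ k₁ k₂ k₃ D₀ D₁ D₂ =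
      let r< , 4c≤e = ++-separated c e g₃ k₃ D₂ z₃≼z₂
          far = relation-neg-+-+ b c e e₂ in
      same-round-⊥ r<
      (neg-+-separated b c g₂ k₂) (neg-+-separated b e g₃ (<-trans k₂ k₃))
      (λ h → contradiction (m+n≡0⇒n≡0 c (opposite-vs-middle (suc b) c e 4c≤e far h)) λ ())
      (λ h → contradiction (m+n≡0⇒n≡0 (c + c) (opposite-vs-last (suc b) c e 4c≤e far h)) λ ())
    by-signs -[1+ a ] -[1+ b ] -[1+ c ] (+ e) (inj₁ (z₀≼z₁ , _ , _)) e₁ e₂ g₁ g₂ g₃ k₁ k₂ k₃ D₀ D₁ D₂ =
      contradiction (first-small′ (suc a) (suc b) (suc c) e (proj₂ (neg-neg-separated a b g₁ k₁ D₀ z₀≼z₁))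
                  (relation-neg-neg-neg a b c e₁) (relation-neg-neg-+ b c e e₂)) λ ()
    by-signs -[1+ a ] -[1+ b ] -[1+ c ] (+ e) (inj₂ (_ , z₁≼z₂ , _)) e₁ e₂ g₁ g₂ g₃ k₁ k₂ k₃ D₀ D₁ D₂ =
      contradiction (first-small (suc b) (suc c) e (proj₂ (neg-neg-separated b c g₂ k₂ D₁ z₁≼z₂))
        (relation-neg-neg-+ b c e e₂)) λ ()
    by-signs (+ a) -[1+ b ] -[1+ c ] -[1+ e ] (inj₁ (_ , _ , z₂≼z₃)) e₁ e₂ g₁ g₂ g₃ k₁ k₂ k₃ D₀ D₁ D₂ =
      contradiction (middle-small (suc b) (suc c) (suc e) (proj₂ (neg-neg-separated c e g₃ k₃ D₂ z₂≼z₃))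
        (relation-neg-neg-neg b c e e₂)) λ ()
    by-signs (+ a) -[1+ b ] -[1+ c ] -[1+ e ] (inj₂ (_ , z₁≼z₂ , _)) e₁ e₂ g₁ g₂ g₃ k₁ k₂ k₃ D₀ D₁ D₂ =
      let r< , 4b≤c = neg-neg-separated b c g₂ k₂ D₁ z₁≼z₂
          far = relation-+-neg-neg a b c e₁ in
      same-round-⊥ r<
      (+-neg-separated a b g₁ k₁) (+-neg-separated a c g₂ (<-trans k₁ k₂))
      (λ h → contradiction (opposite-vs-middle a (suc b) (suc c) 4b≤c far h) λ ())
      (λ h → contradiction (opposite-vs-last a (suc b) (suc c) 4b≤c far h) λ ())
    by-signs (+ a) (+ b) -[1+ c ] -[1+ e ] (inj₁ (_ , _ , z₂≼z₃)) e₁ e₂ g₁ g₂ g₃ k₁ k₂ k₃ D₀ D₁ D₂ =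
      let r< , 4c≤e = neg-neg-separated c e g₃ k₃ D₂ z₂≼z₃
          far = relation-+-neg-neg b c e e₂ in
      same-round-⊥ r<
      (+-neg-separated b c g₂ k₂) (+-neg-separated b e g₃ (<-trans k₂ k₃))
      (λ h → contradiction (opposite-vs-middle b (suc c) (suc e) 4c≤e far h) λ ())
      (λ h → contradiction (opposite-vs-last b (suc c) (suc e) 4c≤e far h) λ ())
    by-signs (+ a) (+ b) -[1+ c ] -[1+ e ] (inj₂ (z₁≼z₀ , _ , _)) e₁ e₂ g₁ g₂ g₃ k₁ k₂ k₃ D₀ D₁ D₂ =
      contradiction (m+n≡0⇒n≡0 (7 * b) (first-small a b (suc c) (proj₂ (++-separated a b g₁ k₁ D₀ z₁≼z₀))
        (relation-+-+-neg a b c e₁))) λ ()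
    by-signs (+ a) (+ b) (+ c) -[1+ e ] (inj₁ (_ , z₂≼z₁ , _)) e₁ e₂ g₁ g₂ g₃ k₁ k₂ k₃ D₀ D₁ D₂ =
      contradiction (m+n≡0⇒n≡0 (7 * c) (first-small b c (suc e) (proj₂ (++-separated b c g₂ k₂ D₁ z₂≼z₁))
        (relation-+-+-neg b c e e₂))) λ ()
    by-signs (+ a) (+ b) (+ c) -[1+ e ] (inj₂ (z₁≼z₀ , _ , _)) e₁ e₂ g₁ g₂ g₃ k₁ k₂ k₃ D₀ D₁ D₂ =
      contradiction (m+n≡0⇒n≡0 (5 * b) (first-small′ a b c (suc e) (proj₂ (++-separated a b g₁ k₁ D₀ z₁≼z₀))
        (ℤ.+-injective e₁) (relation-+-+-neg b c e e₂))) λ ()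
    -- Each middle term would be at least twice the other in absolute value.
    by-signs (+ a) -[1+ b ] -[1+ c ] (+ e) _ e₁ e₂ _ _ _ _ _ _ _ _ _ =
      contradiction (both-far a (suc b) (suc c) e (relation-+-neg-neg a b c e₁) (relation-neg-neg-+ b c e e₂)) λ ()
    by-signs -[1+ a ] (+ b) (+ c) -[1+ e ] _ e₁ e₂ _ _ _ _ _ _ _ _ _ =
      contradiction (m+n≡0⇒n≡0 (b + c) (both-far (suc a) b c (suc e)
        (relation-neg-+-+ a b c e₁) (relation-+-+-neg b c e e₂))) λ ()
    by-signs (+ _) -[1+ _ ] (+ _) _ _ () _
    by-signs -[1+ _ ] (+ _) -[1+ _ ] _ _ () _
    by-signs _ (+ _) -[1+ _ ] (+ _) _ _ () _
    by-signs _ -[1+ _ ] (+ _) -[1+ _ ] _ _ () _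

  no-monotone-progression : ∀ x d →
    let z₁ = x ℤ.+ d; z₂ = z₁ ℤ.+ d; z₃ = z₂ ℤ.+ d in
    ¬ Gap z₁ → ¬ Gap z₂ → ¬ Gap z₃ →
    key x < key z₁ → key z₁ < key z₂ → key z₂ < key z₃ → ⊥
  no-monotone-progression x d g₁ g₂ g₃ k₁ k₂ k₃ =
    -- The final `≤-refl` sets the number of compared digits to the depth of the last term's round,
    -- the largest of the four depths.
    no-monotone-zigzag _ _ _ _ _ (zigzag _ x d) (three-terms x) (three-terms (x ℤ.+ d))
      g₁ g₂ g₃ k₁ k₂ k₃ ≤-refl
    where
    open ℤ.+-*-Solver
    three-terms : ∀ x → x ℤ.+ (x ℤ.+ d ℤ.+ d) ≡ (x ℤ.+ d) ℤ.+ (x ℤ.+ d)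
    three-terms x = solve 2 (λ x d → x :+ (x :+ d :+ d) := (x :+ d) :+ (x :+ d)) refl x d

-- Listing a set of integers by increasing key.

module Enumeration (S : Pred ℤ 0ℓ) (S? : Decidable S) (key : ℤ → ℕ)
  (key-injective : ∀ x y → key x ≡ key y → x ≡ y)
  (abs≤key : ∀ x → ℤ.∣ x ∣ ℕ.≤ key x)
  (unbounded : ∀ n → ∃[ x ] (S x × n ℕ.≤ key x)) where

  open import Defs using (IsωPermutation)
  open import Data.Integer using (+_; -[1+_])
  open import Data.Nat
  open import Data.Nat.Properties
  open import Data.Product using (_,_; proj₁; proj₂)
  open import Data.Sum using (_⊎_; inj₁; inj₂)
  open import Relation.Binary using (tri<; tri≈; tri>)
  open import Relation.Binary.PropositionalEquality
  open import Relation.Nullary using (Dec; yes; no; contradiction; _×-dec_)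

  HasKey : ℕ → Set
  HasKey t = ∃[ x ] (S x × key x ≡ t)

  -- An element with key `t` has absolute value at most `t`, so a finite search decides.
  hasKey? : ∀ t → Dec (HasKey t)
  hasKey? t
    with anyUpTo? (λ n → S? (+ n) ×-dec (key (+ n) ≟ t)) (suc t)
       | anyUpTo? (λ n → S? -[1+ n ] ×-dec (key -[1+ n ] ≟ t)) t
  ... | yes (n , _ , h) | _ = yes (+ n , h)
  ... | no _ | yes (n , _ , h) = yes (-[1+ n ] , h)
  ... | no ¬p | no ¬q = no λ
    { (+ n , Sn , refl)      → ¬p (n , s≤s (abs≤key (+ n)) , Sn , refl)
    ; (-[1+ n ] , Sn , refl) → ¬q (n , abs≤key -[1+ n ] , Sn , refl) }

  Least : ℕ → Set
  Least t = ∃[ x ] (S x × t ≤ key x × (∀ y → S y → t ≤ key y → key x ≤ key y))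

  -- An upward search from `t`; `k` is the distance to a key known to occur.
  least-below : ∀ k t → HasKey (k + t) → Least t
  least-below zero    t (x , Sx , refl) = x , Sx , ≤-refl , λ _ _ le → le
  least-below (suc k) t h with hasKey? t
  ... | yes (x , Sx , refl) = x , Sx , ≤-refl , λ _ _ le → le
  ... | no ¬h with least-below k (suc t) (subst HasKey (sym (+-suc k t)) h)
  ...   | x , Sx , t<x , least = x , Sx , <⇒≤ t<x , λ y Sy t≤y →
    least y Sy (≤∧≢⇒< t≤y λ e → ¬h (y , Sy , sym e))

  opaque
    least : ∀ t → Least t
    least t = let x , Sx , t≤x = unbounded t in
      least-below (key x ∸ t) t (x , Sx , sym (m∸n+n≡m t≤x))

  start : ℕ → ℕ
  enum  : ℕ → ℤ
  start zero    = 0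
  start (suc i) = suc (key (enum i))
  enum i = proj₁ (least (start i))

  key-enum-suc : ∀ i → key (enum i) < key (enum (suc i))
  key-enum-suc i = proj₁ (proj₂ (proj₂ (least (start (suc i)))))

  key-enum-mono : ∀ i j → i < j → key (enum i) < key (enum j)
  key-enum-mono i (suc j) (s≤s i≤j) with m≤n⇒m<n∨m≡n i≤j
  ... | inj₁ i<j  = <-trans (key-enum-mono i j i<j) (key-enum-suc j)
  ... | inj₂ refl = key-enum-suc i

  i≤key-enum : ∀ i → i ≤ key (enum i)
  i≤key-enum zero    = z≤n
  i≤key-enum (suc i) = ≤-<-trans (i≤key-enum i) (key-enum-suc i)

  -- An element not yet listed remains a candidate, so the listed keys cannot pass its key. As they
  -- grow at least like the index, every element is reached.
  reached-or-below : ∀ x → S x → ∀ i → (∃[ j ] enum j ≡ x) ⊎ key (enum i) ≤ key x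
  reached-or-below x Sx zero = inj₂ (proj₂ (proj₂ (proj₂ (least 0))) x Sx z≤n)
  reached-or-below x Sx (suc i) with reached-or-below x Sx i
  ... | inj₁ r  = inj₁ r
  ... | inj₂ le with m≤n⇒m<n∨m≡n le
  ...   | inj₁ lt = inj₂ (proj₂ (proj₂ (proj₂ (least (start (suc i))))) x Sx lt)
  ...   | inj₂ e  = inj₁ (i , key-injective (enum i) x e)

  enum-surjective : ∀ x → S x → ∃[ i ] enum i ≡ x
  enum-surjective x Sx with reached-or-below x Sx (suc (key x))
  ... | inj₁ r  = r
  ... | inj₂ le = contradiction (≤-trans (i≤key-enum (suc (key x))) le) (<⇒≱ ≤-refl)

  enum-injective : ∀ i j → enum i ≡ enum j → i ≡ j
  enum-injective i j e with <-cmp i j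
  ... | tri≈ _ i≡j _ = i≡j
  ... | tri< lt _ _  = contradiction (cong key e) (<⇒≢ (key-enum-mono i j lt))
  ... | tri> _ _ gt  = contradiction (cong key (sym e)) (<⇒≢ (key-enum-mono j i gt))

  enum-isωPermutation : IsωPermutation S enum
  enum-isωPermutation = record
    { mem  = λ i → proj₁ (proj₂ (least (start i)))
    ; once = λ x Sx → let i , e = enum-surjective x Sx in
        i , e , λ {j} e′ → enum-injective i j (trans e (sym e′))
    }

-- Sets that avoid the gaps are 4-permutable.

module GapPermutation (K : ℕ) where

  open TimeKey K
  open MonotoneProgressions K
  open import Defs using (Permutable; IsωPermutation)
  open import Data.Fin using (#_)
  open import Data.Integer as ℤ using (+_)
  import Data.Integer.Properties as ℤ
  import Data.Integer.Solver as ℤ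
  open import Data.Nat
  open import Data.Product using (_,_)
  open import Relation.Binary.PropositionalEquality
  open import Relation.Nullary using (¬_)

  gap-permutable : (S : Pred ℤ 0ℓ) → Decidable S → (∀ x → S x → ¬ Gap x) →
    (∀ n → ∃[ x ] (S x × n ≤ key x)) → Permutable 4 S
  gap-permutable S S? ¬gap unbounded = enum , enum-isωPermutation , λ (i , x , d , i-mono , _ , at) →
    let at₁ = trans (at (# 1)) (solve 2 (λ x d → x :+ con (+ 1) :* d := x :+ d) refl x d)
        at₂ = trans (at (# 2)) (solve 2 (λ x d → x :+ con (+ 2) :* d := x :+ d :+ d) refl x d)
        at₃ = trans (at (# 3)) (solve 2 (λ x d → x :+ con (+ 3) :* d := x :+ d :+ d :+ d) refl x d)
        at₀ = trans (at (# 0)) (solve 2 (λ x d → x :+ con (+ 0) :* d := x) refl x d)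
        no-gap = λ {y} j (e : enum (i j) ≡ y) → ¬gap y (subst S e (IsωPermutation.mem enum-isωPermutation (i j)))
        later = λ {y z} j k j<k (e : enum (i j) ≡ y) (e′ : enum (i k) ≡ z) →
          subst₂ (λ y z → key y < key z) e e′ (key-enum-mono (i j) (i k) (i-mono j k j<k))
    in no-monotone-progression x d (no-gap (# 1) at₁) (no-gap (# 2) at₂) (no-gap (# 3) at₃)
      (later (# 0) (# 1) (s≤s z≤n) at₀ at₁) (later (# 1) (# 2) (s≤s (s≤s z≤n)) at₁ at₂)
      (later (# 2) (# 3) (s≤s (s≤s (s≤s z≤n))) at₂ at₃)
    where
    open Enumeration S S? key key-injective abs≤key unbounded
    open ℤ.+-*-Solver

-- Counting the true values of a Boolean sequence.

module Counting where

  open BitReversal using (digitℕ)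
  open import Data.Bool using (true; false; not)
  open import Data.List using (length; filter; applyUpTo)
  open import Data.Nat
  open import Data.Nat.Properties
  open import Data.Product using (_,_)
  open import Relation.Binary.PropositionalEquality hiding ([_])
  open import Relation.Nullary using (does; contradiction)

  count : (ℕ → Bool) → ℕ → ℕ
  count f zero    = 0
  count f (suc n) = count f n + digitℕ (f n)

  count-+ : ∀ f m n → count f (m + n) ≡ count f m + count (λ i → f (m + i)) n
  count-+ f m zero    = trans (cong (count f) (+-identityʳ m)) (sym (+-identityʳ _))
  count-+ f m (suc n) = begin
    count f (m + suc n)                                              ≡⟨ cong (count f) (+-suc m n) ⟩
    count f (m + n) + digitℕ (f (m + n))                             ≡⟨ cong (_+ digitℕ (f (m + n))) (count-+ f m n) ⟩
    count f m + count (λ i → f (m + i)) n + digitℕ (f (m + n))       ≡⟨ +-assoc (count f m) _ _ ⟩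
    count f m + count (λ i → f (m + i)) (suc n)                      ∎
    where open ≡-Reasoning

  count-cong : ∀ f g n → (∀ i → i < n → f i ≡ g i) → count f n ≡ count g n
  count-cong f g zero    _  = refl
  count-cong f g (suc n) eq = cong₂ _+_ (count-cong f g n λ i i<n → eq i (m<n⇒m<1+n i<n))
    (cong digitℕ (eq n ≤-refl))

  count-mono : ∀ f {m n} → m ≤ n → count f m ≤ count f n
  count-mono f {m} m≤n with m≤n⇒∃[o]m+o≡n m≤n
  ... | o , refl = ≤-trans (m≤m+n (count f m) _) (≤-reflexive (sym (count-+ f m o)))

  count-true : ∀ f n → (∀ i → i < n → f i ≡ true) → count f n ≡ n
  count-true f n all = trans (count-cong f (λ _ → true) n all) (const-true n)
    where
    const-true : ∀ n → count (λ _ → true) n ≡ n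
    const-true zero    = refl
    const-true (suc n) = trans (+-comm _ 1) (cong suc (const-true n))

  count-false : ∀ f n → (∀ i → i < n → f i ≡ false) → count f n ≡ 0
  count-false f zero    _   = refl
  count-false f (suc n) all = trans (cong₂ _+_ (count-false f n λ i i<n → all i (m<n⇒m<1+n i<n))
    (cong digitℕ (all n ≤-refl))) refl

  count-unique : ∀ f n → (∀ i j → i < n → j < n → f i ≡ true → f j ≡ true → i ≡ j) → count f n ≤ 1
  count-unique f zero    _    = z≤n
  count-unique f (suc n) uniq with f n in fn
  ... | false = ≤-trans (≤-reflexive (+-identityʳ _)) (count-unique f n
    λ i j i<n j<n → uniq i j (m<n⇒m<1+n i<n) (m<n⇒m<1+n j<n))
  ... | true  = ≤-reflexive (cong (_+ 1) (count-false f n others))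
    where
    others : ∀ i → i < n → f i ≡ false
    others i i<n with f i in fi
    ... | false = refl
    ... | true  = contradiction (uniq i n (m<n⇒m<1+n i<n) ≤-refl fi fn) (<⇒≢ i<n)

  count-suc : ∀ f n → count f (suc n) ≡ digitℕ (f 0) + count (λ i → f (suc i)) n
  count-suc f n = count-+ f 1 n

  count-reverse : ∀ (f : ℕ → Bool) n → count (λ i → f (n ∸ i)) n ≡ count (λ i → f (suc i)) n
  count-reverse f zero    = refl
  count-reverse f (suc n) = begin
    count (λ i → f (suc n ∸ i)) (suc n)              ≡⟨ count-suc (λ i → f (suc n ∸ i)) n ⟩
    digitℕ (f (suc n)) + count (λ i → f (n ∸ i)) n   ≡⟨ cong (_+_ (digitℕ (f (suc n)))) (count-reverse f n) ⟩
    digitℕ (f (suc n)) + count (λ i → f (suc i)) n   ≡⟨ +-comm (digitℕ (f (suc n))) _ ⟩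
    count (λ i → f (suc i)) (suc n)                  ∎
    where open ≡-Reasoning

  count-not : ∀ f n → count (λ i → not (f i)) n + count f n ≡ n
  count-not f zero    = refl
  count-not f (suc n) with f n
  ... | true  = trans (cong (_+ (count f n + 1)) (+-identityʳ k)) (trans (sym (+-assoc k (count f n) 1))
                  (trans (+-comm _ 1) (cong suc (count-not f n))))
    where k = count (λ i → not (f i)) n
  ... | false = trans (cong (_+_ (k + 1)) (+-identityʳ (count f n)))
                  (trans (cong (_+ count f n) (+-comm k 1)) (cong suc (count-not f n)))
    where k = count (λ i → not (f i)) n

  length-filter-applyUpTo : ∀ {A : Set} {P : Pred A 0ℓ} (P? : Decidable P) (g : ℕ → A) n →
    length (filter P? (applyUpTo g n)) ≡ count (λ i → does (P? (g i))) n
  length-filter-applyUpTo P? g zero    = refl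
  length-filter-applyUpTo P? g (suc n) = trans head-tail (sym (count-suc (λ i → does (P? (g i))) n))
    where
    head-tail : length (filter P? (applyUpTo g (suc n))) ≡
      digitℕ (does (P? (g 0))) + count (λ i → does (P? (g (suc i)))) n
    head-tail with does (P? (g 0))
    ... | true  = cong suc (length-filter-applyUpTo P? (λ i → g (suc i)) n)
    ... | false = length-filter-applyUpTo P? (λ i → g (suc i)) n

-- Symmetric sets given by their removed absolute values.

module SymmetricSet (removed : ℕ → Bool) (keep-0 : removed 0 ≡ Bool.false) where

  open Counting
  open BitReversal using (digitℕ)
  open import Defs using (symmetricInterval)
  open import Data.Bool using (true; false; not)
  open import Data.Integer using (+_)
  import Data.Integer.Properties as ℤ
  open import Data.List using (length; filter; applyUpTo)
  open import Data.List.Properties using (map-upTo)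
  open import Data.Nat
  open import Data.Nat.Properties
  open import Data.Nat.Solver using (module +-*-Solver)
  open import Data.Product using (_,_)
  open import Relation.Binary.PropositionalEquality hiding ([_])
  open import Relation.Nullary using (does; yes; no; contradiction)

  Kept : Pred ℤ 0ℓ
  Kept x = removed ℤ.∣ x ∣ ≡ false

  kept? : Decidable Kept
  kept? x = removed ℤ.∣ x ∣ Bool.≟ false

  -- The parts `[-n, -1]` and `[0, n]` of the interval contribute equally because 0 is kept.
  count-centred : ∀ n → count (λ i → removed ℤ.∣ + i ℤ.- + n ∣) (n + suc n) ≡ 2 * count removed (suc n)
  count-centred n = begin
    count (λ i → removed ℤ.∣ + i ℤ.- + n ∣) (n + suc n)
      ≡⟨ count-+ _ n (suc n) ⟩
    count (λ i → removed ℤ.∣ + i ℤ.- + n ∣) n + count (λ i → removed ℤ.∣ + (n + i) ℤ.- + n ∣) (suc n)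
      ≡⟨ cong₂ _+_ (count-cong _ _ n λ i i<n → cong removed (left i i<n))
                   (count-cong _ _ (suc n) λ i _ → cong removed (right i)) ⟩
    count (λ i → removed (n ∸ i)) n + count removed (suc n)
      ≡⟨ cong (_+ count removed (suc n)) (count-reverse removed n) ⟩
    count (λ i → removed (suc i)) n + count removed (suc n)
      ≡⟨ cong (_+ count removed (suc n)) (sym (trans (count-suc removed n)
           (cong (λ b → digitℕ b + count (λ i → removed (suc i)) n) keep-0))) ⟩
    count removed (suc n) + count removed (suc n)
      ≡⟨ cong (_+_ (count removed (suc n))) (sym (+-identityʳ _)) ⟩
    2 * count removed (suc n) ∎
    where
    open ≡-Reasoning
    left : ∀ i → i < n → ℤ.∣ + i ℤ.- + n ∣ ≡ n ∸ i
    left i i<n = trans (cong ℤ.∣_∣ (ℤ.m-n≡m⊖n i n)) (ℤ.∣⊖∣-≤ (<⇒≤ i<n))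
    right : ∀ i → ℤ.∣ + (n + i) ℤ.- + n ∣ ≡ i
    right i = trans (cong ℤ.∣_∣ (trans (ℤ.m-n≡m⊖n (n + i) n) (ℤ.⊖-≥ (m≤m+n n i)))) (m+n∸m≡n n i)

  kept-count : ∀ n → length (filter kept? (symmetricInterval n)) + 2 * count removed (suc n) ≡ suc (2 * n)
  kept-count n = begin
    length (filter kept? (symmetricInterval n)) + 2 * count removed (suc n)
      ≡⟨ cong₂ (λ xs k → length (filter kept? xs) + k)
           (trans (map-upTo (λ i → + i ℤ.- + n) (suc (2 * n))) (cong (applyUpTo _) 1+2n)) (sym (count-centred n)) ⟩
    length (filter kept? (applyUpTo (λ i → + i ℤ.- + n) (n + suc n))) + count (λ i → removed ℤ.∣ + i ℤ.- + n ∣) (n + suc n)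
      ≡⟨ cong (_+ count (λ i → removed ℤ.∣ + i ℤ.- + n ∣) (n + suc n)) (trans
           (length-filter-applyUpTo kept? (λ i → + i ℤ.- + n) (n + suc n))
           (count-cong _ _ (n + suc n) λ i _ → does-≟-false (removed ℤ.∣ + i ℤ.- + n ∣))) ⟩
    count (λ i → not (removed ℤ.∣ + i ℤ.- + n ∣)) (n + suc n) + count (λ i → removed ℤ.∣ + i ℤ.- + n ∣) (n + suc n)
      ≡⟨ count-not (λ i → removed ℤ.∣ + i ℤ.- + n ∣) (n + suc n) ⟩
    n + suc n
      ≡⟨ sym 1+2n ⟩
    suc (2 * n) ∎
    where
    open ≡-Reasoning
    1+2n : suc (2 * n) ≡ n + suc n
    1+2n = trans (cong (λ m → suc (n + m)) (+-identityʳ n)) (sym (+-suc n n))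
    does-≟-false : ∀ b → does (b Bool.≟ false) ≡ not b
    does-≟-false true  = refl
    does-≟-false false = refl

  -- Otherwise all `n + 2` values from `n` to `2 n + 1` are removed, more than half of those below
  -- `2 n + 2`.
  kept-unbounded : (∀ n → 2 * count removed (suc n) ≤ n) → ∀ n → ∃[ x ] (Kept x × n ≤ ℤ.∣ x ∣)
  kept-unbounded sparse n with anyUpTo? (λ i → removed (n + i) Bool.≟ false) (2 + n)
  ... | yes (i , _ , e) = + (n + i) , e , m≤m+n n i
  ... | no ¬e = contradiction (begin
    (n + suc n) + 3                                    ≡⟨ solve 1 (λ n → (n :+ (con 1 :+ n)) :+ con 3 := con 2 :* (con 2 :+ n)) refl n ⟩
    2 * (2 + n)                                        ≡⟨ cong (_*_ 2) (sym (count-true _ (2 + n) all-removed)) ⟩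
    2 * count (λ i → removed (n + i)) (2 + n)          ≤⟨ *-monoʳ-≤ 2 (m≤n+m _ (count removed n)) ⟩
    2 * (count removed n + count (λ i → removed (n + i)) (2 + n)) ≡⟨ cong (_*_ 2) (sym (count-+ removed n (2 + n))) ⟩
    2 * count removed (n + (2 + n))                    ≡⟨ cong (λ m → 2 * count removed m) (+-suc n (suc n)) ⟩
    2 * count removed (suc (n + suc n))                ≤⟨ sparse (n + suc n) ⟩
    n + suc n                                          ∎) (<⇒≱ (m<m+n (n + suc n) (s≤s z≤n)))
    where
    open ≤-Reasoning
    open +-*-Solver
    all-removed : ∀ i → i < 2 + n → removed (n + i) ≡ true
    all-removed i i< with removed (n + i) in e
    ... | true  = refl
    ... | false = contradiction (i , i< , e) ¬e

-- Greedy removal of blocks.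

-- Block b ≥ 1 of 2 ^ K consecutive absolute values is removed entirely if
-- test b t holds, where t is the number of removals below it; otherwise only
-- the element lying in a gap is removed.
module Removal (K : ℕ) (test : ℕ → ℕ → Bool) where

  open BitReversal using (rev<2^; rev-injective)
  open TimeKey K
  open Counting
  open import Data.Bool using (true; false; _∨_; if_then_else_)
  open import Data.Bool.Properties using (∨-zeroʳ; ∨-identityʳ)
  open import Data.Integer using (+_; -[1+_])
  import Data.Integer.Properties as ℤ
  open import Data.Nat
  open import Data.Nat.Divisibility using (divides-refl)
  open import Data.Nat.DivMod
  open import Data.Nat.Properties
  open import Data.Product using (_,_)
  open import Relation.Binary using (tri<; tri≈; tri>)
  open import Relation.Binary.PropositionalEquality
  open import Relation.Nullary using (¬_; yes; no; does; contradiction; _×-dec_)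

  ∣m-n∣<M : ∀ m n → m / M ≡ n / M → ℤ.∣ m ℤ.⊖ n ∣ < M
  ∣m-n∣<M m n e = subst (λ i → ℤ.∣ i ∣ < M) (sym (begin
    m ℤ.⊖ n                                              ≡⟨ cong₂ ℤ._⊖_ (split m) (split n) ⟩
    (m / M * M + m % M) ℤ.⊖ (n / M * M + n % M)          ≡⟨ cong (λ q → (m / M * M + m % M) ℤ.⊖ (q * M + n % M)) (sym e) ⟩
    (m / M * M + m % M) ℤ.⊖ (m / M * M + n % M)          ≡⟨ ℤ.+-cancelˡ-⊖ (m / M * M) (m % M) (n % M) ⟩
    (m % M) ℤ.⊖ (n % M)                                  ∎)) (∣m⊖n∣<o (m%n<n m M) (m%n<n n M))
    where
    open ≡-Reasoning
    split : ∀ m → m ≡ m / M * M + m % M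
    split m = trans (m≡m%n+[m/n]*n m M) (+-comm (m % M) _)

  W-apart : ∀ s {u v} q r → q < r → s + u ≡ q * W → s + v ≡ r * W → W ≤ v
  W-apart s {u} {v} q r q<r e f = +-cancelˡ-≤ s W v (begin
    s + W       ≤⟨ +-monoˡ-≤ W (m≤m+n s u) ⟩
    s + u + W   ≡⟨ trans (cong (_+ W) e) (+-comm (q * W) W) ⟩
    suc q * W   ≤⟨ *-monoˡ-≤ W q<r ⟩
    r * W       ≡⟨ sym f ⟩
    s + v       ∎)
    where open ≤-Reasoning

  multiples-within : ∀ s {u v} q r → u < W → v < W → s + u ≡ q * W → s + v ≡ r * W → u ≡ v
  multiples-within s q r u<W v<W e f with <-cmp q r
  ... | tri≈ _ refl _ = +-cancelˡ-≡ s _ _ (trans e (sym f))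
  ... | tri< q<r _ _  = contradiction v<W (≤⇒≯ (W-apart s q r q<r e f))
  ... | tri> _ _ r<q  = contradiction u<W (≤⇒≯ (W-apart s r q r<q f e))

  -- Within a block the scales agree, so the phases differ by less than `W`; both are multiples of
  -- `W`, hence equal.
  gap⇒stream≡ : ∀ x y → Gap x → Gap y → ℤ.∣ x ∣ / M ≡ ℤ.∣ y ∣ / M → stream x ≡ stream y
  gap⇒stream≡ x y (_ , x≡0) (_ , y≡0) e = suc-injective
    (∸-cancelˡ-≡ (stream<W x) (stream<W y)
      (multiples-within (scale x) (round x) (round y) (offset<W x) (offset<W y)
        (trans (phase-divMod x) (cong (_+ round x * W) x≡0))
        (trans (cong (λ b → level b + (W ∸ suc (stream y))) e)
          (trans (phase-divMod y) (cong (_+ round y * W) y≡0)))))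
    where
    offset<W : ∀ z → W ∸ suc (stream z) < W
    offset<W z = ∸-monoʳ-< z<s (stream<W z)

  -- A block meets each stream at most once: the stream fixes the sign and the residue modulo `M`.
  gap-unique : ∀ x y → Gap x → Gap y → ℤ.∣ x ∣ / M ≡ ℤ.∣ y ∣ / M → x ≡ y
  gap-unique x@(+ m) y@(+ n) gx gy e = rev-injective K x y
    (subst (λ i → ℤ.∣ i ∣ < M) (sym (ℤ.m-n≡m⊖n m n)) (∣m-n∣<M m n e))
    (suc-injective (∸-cancelˡ-≡ (rev<2^ K x) (rev<2^ K y) (+-cancelˡ-≡ M _ _ (gap⇒stream≡ x y gx gy e))))
  gap-unique x@(-[1+ m ]) y@(-[1+ n ]) gx gy e = rev-injective K x y
    (∣m-n∣<M (suc n) (suc m) (sym e)) (gap⇒stream≡ x y gx gy e)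
  gap-unique x@(+ m) y@(-[1+ n ]) gx gy e =
    contradiction (m≤m+n M _) (<⇒≱ (subst (_< M) (sym (gap⇒stream≡ x y gx gy e)) (rev<2^ K y)))
  gap-unique x@(-[1+ m ]) y@(+ n) gx gy e =
    contradiction (m≤m+n M _) (<⇒≱ (subst (_< M) (gap⇒stream≡ x y gx gy e) (rev<2^ K x)))

  opaque
    gap? : Decidable Gap
    gap? x = (0 <? scale x) ×-dec (phase x % W ≟ 0)

  forced : ℕ → Bool
  forced n = does (gap? (+ n)) ∨ does (gap? (ℤ.- + n))

  ∣-n∣≡n : ∀ n → ℤ.∣ ℤ.- + n ∣ ≡ n
  ∣-n∣≡n n = ℤ.∣-i∣≡∣i∣ (+ n)

  GapAt : ℕ → Set
  GapAt n = ∃[ x ] (Gap x × ℤ.∣ x ∣ ≡ n)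

  forced⇒gap : ∀ n → forced n ≡ true → GapAt n
  forced⇒gap n e with gap? (+ n) | gap? (ℤ.- + n)
  ... | yes g | _     = + n , g , refl
  ... | no _  | yes g = ℤ.- + n , g , ∣-n∣≡n n

  unforced⇒¬gap : ∀ x → forced ℤ.∣ x ∣ ≡ false → ¬ Gap x
  unforced⇒¬gap (+ n) e g with gap? (+ n)
  ... | no ¬g = ¬g g
  unforced⇒¬gap -[1+ n ] e g with gap? (+ suc n) | gap? -[1+ n ]
  ... | no _ | no ¬g = ¬g g

  block-/ : ∀ b i → i < M → (b * M + i) / M ≡ b
  block-/ b i i<M = begin
    (b * M + i) / M     ≡⟨ +-distrib-/-∣ˡ i (divides-refl b) ⟩
    b * M / M + i / M   ≡⟨ cong₂ _+_ (m*n/n≡m b M) (m<n⇒m/n≡0 i<M) ⟩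
    b + 0               ≡⟨ +-identityʳ b ⟩
    b                   ∎
    where open ≡-Reasoning

  forced-unique : ∀ b → count (λ i → forced (b * M + i)) M ≤ 1
  forced-unique b = count-unique _ M λ i j i<M j<M fi fj → +-cancelˡ-≡ (b * M) i j (
    let x , gx , ex = forced⇒gap _ fi
        y , gy , ey = forced⇒gap _ fj
    in trans (sym ex) (trans (cong ℤ.∣_∣ (gap-unique x y gx gy (trans (cong (_/ M) ex)
         (trans (block-/ b i i<M) (trans (sym (block-/ b j j<M)) (cong (_/ M) (sym ey))))))) ey))

  forced-below-M : ∀ i → i < M → forced i ≡ false
  forced-below-M i i<M with forced i in fi
  ... | false = refl
  ... | true  with forced⇒gap i fi
  ...   | x , (0<scale , _) , ex = contradiction 0<scale
    (≤⇒≯ (≤-reflexive (cong level (trans (cong (_/ M) ex) (m<n⇒m/n≡0 i<M)))))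

  opaque
    heavy : ℕ → Bool
    total : ℕ → ℕ
    -- Sparing block 0 keeps 0 in the set and makes `total 1` zero, where the induction on the
    -- budget starts.
    heavy zero    = false
    heavy (suc b) = test (suc b) (total (suc b))
    total zero    = 0
    total (suc b) = total b + (if heavy b then M else count (λ i → forced (b * M + i)) M)

    heavy-0 : heavy 0 ≡ false
    heavy-0 = refl

    heavy-suc : ∀ b → heavy (suc b) ≡ test (suc b) (total (suc b))
    heavy-suc b = refl

    total-0 : total 0 ≡ 0
    total-0 = refl

    total-suc : ∀ b → total (suc b) ≡ total b + (if heavy b then M else count (λ i → forced (b * M + i)) M)
    total-suc b = refl

  removed : ℕ → Bool
  removed n = forced n ∨ heavy (n / M)

  removed-block : ∀ b i → i < M → removed (b * M + i) ≡ forced (b * M + i) ∨ heavy b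
  removed-block b i i<M = cong (λ c → forced (b * M + i) ∨ heavy c) (block-/ b i i<M)

  keep-0 : removed 0 ≡ false
  keep-0 = cong₂ _∨_ (forced-below-M 0 0<M) (trans (cong heavy (m<n⇒m/n≡0 0<M)) heavy-0)
    where
    0<M : 0 < M
    0<M = m^n>0 2 K

  removed-in-block : ∀ b → count (λ i → removed (b * M + i)) M ≡
    (if heavy b then M else count (λ i → forced (b * M + i)) M)
  removed-in-block b with heavy b in hb
  ... | true  = count-true _ M λ i i<M → trans (removed-block b i i<M)
    (trans (cong (forced (b * M + i) ∨_) hb) (∨-zeroʳ _))
  ... | false = count-cong _ _ M λ i i<M → trans (removed-block b i i<M)
    (trans (cong (forced (b * M + i) ∨_) hb) (∨-identityʳ _))

  count-removed : ∀ b → count removed (b * M) ≡ total b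
  count-removed zero    = sym total-0
  count-removed (suc b) = trans (cong (count removed) (+-comm M (b * M)))
    (trans (count-+ removed (b * M) M)
      (trans (cong₂ _+_ (count-removed b) (removed-in-block b)) (sym (total-suc b))))

  total-light : ∀ b → heavy b ≡ false → total (suc b) ≤ total b + 1
  total-light b hb rewrite total-suc b | hb = +-monoʳ-≤ (total b) (forced-unique b)

  total-heavy : ∀ b → heavy b ≡ true → total (suc b) ≡ total b + M
  total-heavy b hb rewrite total-suc b | hb = refl

  total-1 : total 1 ≡ 0
  total-1 rewrite total-suc 0 | heavy-0 | total-0 = count-false forced M forced-below-M

  open SymmetricSet removed keep-0 public

  kept⇒¬gap : ∀ x → Kept x → ¬ Gap x
  kept⇒¬gap x kept = unforced⇒¬gap x (∨-false (forced ℤ.∣ x ∣) kept)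
    where
    ∨-false : ∀ b {c} → b ∨ c ≡ false → b ≡ false
    ∨-false false _ = refl

  open GapPermutation K
  open import Defs using (Permutable)

  kept-permutable : (∀ n → 2 * count removed (suc n) ≤ n) → Permutable 4 Kept
  kept-permutable sparse = gap-permutable Kept kept? kept⇒¬gap λ n →
    let x , kept , n≤ = kept-unbounded sparse n in x , kept , ≤-trans n≤ (abs≤key x)

-- Natural numbers inside the rationals.

module RationalLemmas where

  open import Data.Integer using (+_)
  import Data.Integer.Properties as ℤ
  import Data.Nat.Properties as ℕ
  open import Data.Product using (_,_)
  open import Data.Rational
  open import Data.Rational.Properties
  import Data.Rational.Unnormalised as ℚᵘ
  import Data.Rational.Unnormalised.Properties as ℚᵘ
  open import Data.Sum using (inj₁; inj₂)
  open import Relation.Binary.PropositionalEquality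
  open import Relation.Nullary using (¬_)

  toℚᵘ-/ : ∀ p q → toℚᵘ (p / ℕ.suc q) ℚᵘ.≃ ℚᵘ.mkℚᵘ p q
  toℚᵘ-/ p q = toℚᵘ-fromℚᵘ (ℚᵘ.mkℚᵘ p q)

  opaque
    ι : ℕ → ℚ
    ι n = + n / 1

    ι≡/1 : ∀ n → ι n ≡ + n / 1
    ι≡/1 n = refl

    ι-0 : ι 0 ≡ 0ℚ
    ι-0 = refl

    ι-1 : ι 1 ≡ 1ℚ
    ι-1 = refl

    ι-+ : ∀ m n → ι (m ℕ.+ n) ≡ ι m + ι n
    ι-+ m n = toℚᵘ-injective (ℚᵘ.≃-trans (toℚᵘ-/ (+ (m ℕ.+ n)) 0)
      (ℚᵘ.≃-trans (ℚᵘ.*≡* (cong (ℤ._* + 1) (cong₂ ℤ._+_ (sym (ℤ.*-identityʳ (+ m))) (sym (ℤ.*-identityʳ (+ n))))))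
        (ℚᵘ.≃-sym (ℚᵘ.≃-trans (toℚᵘ-homo-+ (ι m) (ι n)) (ℚᵘ.+-cong (toℚᵘ-/ (+ m) 0) (toℚᵘ-/ (+ n) 0))))))

    ι-* : ∀ m n → ι (m ℕ.* n) ≡ ι m * ι n
    ι-* m n = toℚᵘ-injective (ℚᵘ.≃-trans (toℚᵘ-/ (+ (m ℕ.* n)) 0)
      (ℚᵘ.≃-trans (ℚᵘ.*≡* (cong (ℤ._* + 1) (ℤ.pos-* m n)))
        (ℚᵘ.≃-sym (ℚᵘ.≃-trans (toℚᵘ-homo-* (ι m) (ι n)) (ℚᵘ.*-cong (toℚᵘ-/ (+ m) 0) (toℚᵘ-/ (+ n) 0))))))

    ι-mono-≤ : ∀ {m n} → m ℕ.≤ n → ι m ≤ ι n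
    ι-mono-≤ {m} {n} m≤n = toℚᵘ-cancel-≤ (ℚᵘ.≤-respˡ-≃ (ℚᵘ.≃-sym (toℚᵘ-/ (+ m) 0))
      (ℚᵘ.≤-respʳ-≃ (ℚᵘ.≃-sym (toℚᵘ-/ (+ n) 0)) (ℚᵘ.*≤* (ℤ.*-monoʳ-≤-nonNeg (+ 1) (ℤ.+≤+ m≤n)))))

    ι-cancel-≤ : ∀ {m n} → ι m ≤ ι n → m ℕ.≤ n
    ι-cancel-≤ {m} {n} le = ℤ.drop‿+≤+ (subst₂ ℤ._≤_ (ℤ.*-identityʳ (+ m)) (ℤ.*-identityʳ (+ n))
      (ℚᵘ.drop-*≤* (ℚᵘ.≤-respˡ-≃ (toℚᵘ-/ (+ m) 0) (ℚᵘ.≤-respʳ-≃ (toℚᵘ-/ (+ n) 0) (toℚᵘ-mono-≤ le)))))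

    /-*-ι : ∀ p q → (+ p / ℕ.suc q) * ι (ℕ.suc q) ≡ ι p
    /-*-ι p q = toℚᵘ-injective (ℚᵘ.≃-trans (toℚᵘ-homo-* (+ p / ℕ.suc q) (ι (ℕ.suc q)))
      (ℚᵘ.≃-trans (ℚᵘ.*-cong (toℚᵘ-/ (+ p) q) (toℚᵘ-/ (+ ℕ.suc q) 0))
        (ℚᵘ.≃-trans (ℚᵘ.*≡* (trans (ℤ.*-identityʳ _) (cong (λ d → + p ℤ.* + d) (sym (ℕ.*-identityʳ (ℕ.suc q))))))
          (ℚᵘ.≃-sym (toℚᵘ-/ (+ p) 0)))))

  <⇒≱ : ∀ {p q} → p < q → ¬ (q ≤ p)
  <⇒≱ p<q q≤p = <-irrefl refl (<-≤-trans p<q q≤p)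

  p≤∣p∣ : ∀ p → p ≤ ∣ p ∣
  p≤∣p∣ p with ≤-total 0ℚ p
  ... | inj₁ 0≤p = ≤-reflexive (sym (0≤p⇒∣p∣≡p 0≤p))
  ... | inj₂ p≤0 = ≤-trans p≤0 (0≤∣p∣ p)

  ι≥0 : ∀ n → 0ℚ ≤ ι n
  ι≥0 n = subst (_≤ ι n) ι-0 (ι-mono-≤ ℕ.z≤n)

  *-monoˡ : ∀ {p q r} → 0ℚ ≤ r → p ≤ q → p * r ≤ q * r
  *-monoˡ {r = r} r≥0 = *-monoʳ-≤-nonNeg r {{nonNegative r≥0}}

  *-monoʳ : ∀ {p q r} → 0ℚ ≤ r → p ≤ q → r * p ≤ r * q
  *-monoʳ {r = r} r≥0 = *-monoˡ-≤-nonNeg r {{nonNegative r≥0}}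

  *≥0 : ∀ {p q} → 0ℚ ≤ p → 0ℚ ≤ q → 0ℚ ≤ p * q
  *≥0 {p} {q} p≥0 q≥0 = subst (_≤ p * q) (*-zeroˡ q) (*-monoˡ q≥0 p≥0)

  -- For `h = (p + 1) / (q + 1)` the witness is `n (q + 1)`, since `(q + 1) h = p + 1 ≥ 1`.
  archimedean : ∀ n {h} → 0ℚ < h → ∃[ B ] ι n ≤ ι B * h
  archimedean n {h@(mkℚ (+ ℕ.suc p) q _)} _ = n ℕ.* ℕ.suc q , (begin
    ι n                              ≡⟨ sym (trans (cong (ι n *_) ι-1) (*-identityʳ (ι n))) ⟩
    ι n * ι 1                        ≤⟨ *-monoʳ (ι≥0 n) (ι-mono-≤ (ℕ.s≤s ℕ.z≤n)) ⟩
    ι n * ι (ℕ.suc p)                ≡⟨ cong (ι n *_) (sym (/-*-ι (ℕ.suc p) q)) ⟩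
    ι n * ((+ ℕ.suc p / ℕ.suc q) * ι (ℕ.suc q)) ≡⟨ cong (λ h → ι n * (h * ι (ℕ.suc q))) (↥p/↧p≡p h) ⟩
    ι n * (h * ι (ℕ.suc q))          ≡⟨ cong (ι n *_) (*-comm h (ι (ℕ.suc q))) ⟩
    ι n * (ι (ℕ.suc q) * h)          ≡⟨ sym (*-assoc (ι n) (ι (ℕ.suc q)) h) ⟩
    ι n * ι (ℕ.suc q) * h            ≡⟨ cong (_* h) (sym (ι-* n (ℕ.suc q))) ⟩
    ι (n ℕ.* ℕ.suc q) * h            ∎)
    where open ≤-Reasoning
  archimedean n {mkℚ (+ 0) _ _} 0<h with positive 0<h
  ... | ()
  archimedean n {mkℚ ℤ.-[1+ _ ] _ _} 0<h with positive 0<h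
  ... | ()

-- Reals enter the estimates through their approximations, and an inequality is asked for only from
-- some index on.
Eventually : (ℕ → Set) → Set
Eventually P = ∃[ N ] (∀ i → N ℕ.≤ i → P i)

module _ where

  import Data.Nat.Properties as ℕ

  eventually₂ : ∀ {P Q T : ℕ → Set} → (∀ i → P i → Q i → T i) → Eventually P → Eventually Q → Eventually T
  eventually₂ f (M , p) (N , q) = M ℕ.⊔ N , λ i le →
    f i (p i (ℕ.m⊔n≤o⇒m≤o M N le)) (q i (ℕ.m⊔n≤o⇒n≤o M N le))

open import Defs using (ℝ; approx; cauchy)

-- The greedy set for the rate `R` and its lower density.

module Density (K : ℕ) (R : ℝ)
  (R≥1/M : Eventually λ i → 1ℚ ℚ.≤ approx R i ℚ.* RationalLemmas.ι (2 ℕ.^ K))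
  (R≤1/2 : Eventually λ i → approx R i ℚ.+ approx R i ℚ.≤ 1ℚ) where

  open RationalLemmas
  open TimeKey K using (M; M≢0)
  open Counting using (count; count-mono)
  open import Data.Bool using (true; false)
  open import Data.Bool.Properties using (¬-not)
  import Data.List
  import Data.Nat.DivMod as ℕ
  import Data.Nat.Properties as ℕ
  open import Data.Product using (_,_; proj₁; proj₂)
  open import Data.Rational
  open import Data.Rational.Properties
  open import Data.Rational.Solver using (module +-*-Solver)
  open import Relation.Binary.PropositionalEquality
  open import Relation.Nullary using (¬_; Dec; yes; no; does; contradiction)

  r : ℕ → ℚ
  r = approx R

  r≥0 : Eventually λ i → 0ℚ ≤ r i
  r≥0 = proj₁ R≥1/M , λ i i≥ → ≮⇒≥ λ r<0 → contradiction (proj₂ R≥1/M i i≥) (<⇒≱ (begin-strict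
    r i * ι M   ≤⟨ *-monoˡ (ι≥0 M) (<⇒≤ r<0) ⟩
    0ℚ * ι M    ≡⟨ *-zeroˡ (ι M) ⟩
    0ℚ          <⟨ positive⁻¹ 1ℚ ⟩
    1ℚ          ∎))
    where open ≤-Reasoning

  ε : ℕ → ℚ
  ε b = ℤ.+ 1 / ℕ.suc b

  ε*[1+b] : ∀ b → ε b * ι (ℕ.suc b) ≡ 1ℚ
  ε*[1+b] b = trans (/-*-ι 1 b) ι-1

  ε>0 : ∀ b → 0ℚ < ε b
  ε>0 b = ≰⇒> λ ε≤0 → contradiction (*-monoˡ (ι≥0 (ℕ.suc b)) ε≤0) (<⇒≱ (begin-strict
    0ℚ * ι (ℕ.suc b)    ≡⟨ *-zeroˡ (ι (ℕ.suc b)) ⟩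
    0ℚ                  <⟨ positive⁻¹ 1ℚ ⟩
    1ℚ                  ≡⟨ sym (ε*[1+b] b) ⟩
    ε b * ι (ℕ.suc b)   ∎))
    where open ≤-Reasoning

  ε*b≤1 : ∀ b → ε b * ι b ≤ 1ℚ
  ε*b≤1 b = ≤-trans (*-monoʳ (<⇒≤ (ε>0 b)) (ι-mono-≤ (ℕ.n≤1+n b))) (≤-reflexive (ε*[1+b] b))

  modulus : ℕ → ℕ
  modulus b = proj₁ (cauchy R (ε b) (ε>0 b))

  -- A rational lower bound for `R` with error at most `2 ε b`, which makes the test for block `b`
  -- decidable. As `ε b * b ≤ 1`, the error amounts to at most `2 M` removals at `b M`.
  q : ℕ → ℚ
  q b = r (modulus b) - ε b

  q≤r : ∀ b → Eventually λ i → q b ≤ r i × r i ≤ q b + (ε b + ε b)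
  q≤r b = modulus b , λ i i≥ → let close = <⇒≤ (proj₂ (cauchy R (ε b) (ε>0 b)) i (modulus b) i≥ ℕ.≤-refl) in
    (begin
      s - ε b                      ≤⟨ +-monoʳ-≤ s (neg-antimono-≤ (≤-trans (p≤∣p∣ (- (r i - s))) (≤-trans (≤-reflexive (∣-p∣≡∣p∣ (r i - s))) close))) ⟩
      s - - (r i - s)              ≡⟨ solve 2 (λ s x → s :- (:- (x :- s)) := x) refl s (r i) ⟩
      r i                          ∎) ,
    (begin
      r i                          ≡⟨ solve 2 (λ s x → x := s :+ (x :- s)) refl s (r i) ⟩
      s + (r i - s)                ≤⟨ +-monoʳ-≤ s (≤-trans (p≤∣p∣ (r i - s)) close) ⟩
      s + ε b                      ≡⟨ solve 2 (λ s e → s :+ e := (s :- e) :+ (e :+ e)) refl s (ε b) ⟩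
      q b + (ε b + ε b)            ∎)
    where
    open ≤-Reasoning
    open +-*-Solver
    s = r (modulus b)

  opaque
    budget? : ∀ b t → Dec (ι t + ι (2 ℕ.* M) ≤ q b * ι (b ℕ.* M))
    budget? b t = ι t + ι (2 ℕ.* M) ≤? q b * ι (b ℕ.* M)

  open Removal K (λ b t → does (budget? b t))

  does-true : ∀ {A : Set} (a? : Dec A) → does a? ≡ true → A
  does-true (yes a) _ = a

  does-false : ∀ {A : Set} (a? : Dec A) → does a? ≡ false → ¬ A
  does-false (no ¬a) _ = ¬a

  -- Bounding by the start of the last block makes `R n` an upper bound at every `n` inside it. A
  -- light block adds at most one removal, paid for by `1 ≤ R M`; a heavy block is covered by its
  -- budget.
  total-suc≤ : ∀ b → Eventually λ i → ι (total (ℕ.suc b)) ≤ r i * ι (b ℕ.* M)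
  total-suc≤ ℕ.zero = proj₁ r≥0 , λ i i≥ → begin
    ι (total 1)           ≡⟨ trans (cong ι total-1) ι-0 ⟩
    0ℚ                    ≤⟨ *≥0 (proj₂ r≥0 i i≥) (ι≥0 0) ⟩
    r i * ι 0             ∎
    where open ≤-Reasoning
  total-suc≤ (ℕ.suc b) with heavy (ℕ.suc b) in hb
  ... | false = eventually₂ (λ i le 1≤rM → begin
    ι (total (ℕ.suc (ℕ.suc b)))          ≤⟨ ι-mono-≤ (total-light (ℕ.suc b) hb) ⟩
    ι (total (ℕ.suc b) ℕ.+ 1)            ≡⟨ trans (ι-+ (total (ℕ.suc b)) 1) (cong (ι (total (ℕ.suc b)) +_) ι-1) ⟩
    ι (total (ℕ.suc b)) + 1ℚ             ≤⟨ +-mono-≤ le 1≤rM ⟩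
    r i * ι (b ℕ.* M) + r i * ι M        ≡⟨ solve 3 (λ r x m → r :* x :+ r :* m := r :* (m :+ x)) refl (r i) (ι (b ℕ.* M)) (ι M) ⟩
    r i * (ι M + ι (b ℕ.* M))            ≡⟨ cong (r i *_) (sym (ι-+ M (b ℕ.* M))) ⟩
    r i * ι (ℕ.suc b ℕ.* M)              ∎) (total-suc≤ b) R≥1/M
    where
    open ≤-Reasoning
    open +-*-Solver
  ... | true = proj₁ (q≤r (ℕ.suc b)) , λ i i≥ → begin
    ι (total (ℕ.suc (ℕ.suc b)))          ≡⟨ trans (cong ι (total-heavy (ℕ.suc b) hb)) (ι-+ (total (ℕ.suc b)) M) ⟩
    ι (total (ℕ.suc b)) + ι M            ≤⟨ +-monoʳ-≤ (ι (total (ℕ.suc b))) (ι-mono-≤ (ℕ.m≤m+n M _)) ⟩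
    ι (total (ℕ.suc b)) + ι (2 ℕ.* M)    ≤⟨ does-true (budget? (ℕ.suc b) (total (ℕ.suc b))) (trans (sym (heavy-suc b)) hb) ⟩
    q (ℕ.suc b) * ι (ℕ.suc b ℕ.* M)      ≤⟨ *-monoˡ (ι≥0 (ℕ.suc b ℕ.* M)) (proj₁ (proj₂ (q≤r (ℕ.suc b)) i i≥)) ⟩
    r i * ι (ℕ.suc b ℕ.* M)              ∎
    where open ≤-Reasoning

  removed≤ : ∀ n → Eventually λ i → ι (count removed (ℕ.suc n)) ≤ r i * ι n
  removed≤ n = eventually₂ (λ i le r≥0 → begin
    ι (count removed (ℕ.suc n))          ≤⟨ ι-mono-≤ (count-mono removed 1+n≤) ⟩
    ι (count removed (ℕ.suc b ℕ.* M))    ≡⟨ cong ι (count-removed (ℕ.suc b)) ⟩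
    ι (total (ℕ.suc b))                  ≤⟨ le ⟩
    r i * ι (b ℕ.* M)                    ≤⟨ *-monoʳ r≥0 (ι-mono-≤ (ℕ.m/n*n≤m n M)) ⟩
    r i * ι n                            ∎) (total-suc≤ b) r≥0
    where
    open ≤-Reasoning
    b = n ℕ./ M
    1+n≤ : ℕ.suc n ℕ.≤ ℕ.suc b ℕ.* M
    1+n≤ = subst (ℕ._< ℕ.suc b ℕ.* M) (sym (ℕ.m≡m%n+[m/n]*n n M)) (ℕ.+-monoˡ-< (b ℕ.* M) (ℕ.m%n<n n M))

  double≤ : ∀ {x} i n → r i + r i ≤ 1ℚ → x ≤ r i * ι n → x + x ≤ ι n
  double≤ {x} i n 2r≤1 le = begin
    x + x                        ≤⟨ +-mono-≤ le le ⟩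
    r i * ι n + r i * ι n        ≡⟨ sym (*-distribʳ-+ (ι n) (r i) (r i)) ⟩
    (r i + r i) * ι n            ≤⟨ *-monoˡ (ι≥0 n) 2r≤1 ⟩
    1ℚ * ι n                     ≡⟨ *-identityˡ (ι n) ⟩
    ι n                          ∎
    where open ≤-Reasoning

  ι-2* : ∀ n → ι (2 ℕ.* n) ≡ ι n + ι n
  ι-2* n = trans (cong (λ m → ι (n ℕ.+ m)) (ℕ.+-identityʳ n)) (ι-+ n n)

  sparse : ∀ n → 2 ℕ.* count removed (ℕ.suc n) ℕ.≤ n
  sparse n = let N , le = eventually₂ (λ i → double≤ i n) R≤1/2 (removed≤ n) in
    ι-cancel-≤ (subst (_≤ ι n) (sym (ι-2* (count removed (ℕ.suc n)))) (le N ℕ.≤-refl))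

  open import Defs as ℝ using (densityAt; HasLowerDensity; Permutable; fromℕ; mk<)

  permutable : Permutable 4 Kept
  permutable = kept-permutable sparse

  -- The sequence representing this real is constant, so index 0 gives its value.
  density : ℕ → ℚ
  density n = approx (densityAt Kept kept? n) 0

  width : ℕ → ℚ
  width n = ι (ℕ.suc (2 ℕ.* n))

  width-≡ : ∀ n → width n ≡ 1ℚ + (ι n + ι n)
  width-≡ n = trans (ι-+ 1 (2 ℕ.* n)) (cong₂ _+_ ι-1 (ι-2* n))

  width>0 : ∀ n → Positive (width n)
  width>0 n = positive (<-≤-trans (positive⁻¹ 1ℚ) (subst (_≤ width n) ι-1 (ι-mono-≤ (ℕ.s≤s ℕ.z≤n))))

  density-width : ∀ n → let C = ι (count removed (ℕ.suc n)) in density n * width n + (C + C) ≡ width n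
  density-width n = begin
    density n * width n + (ι C + ι C)    ≡⟨ cong₂ _+_ (/-*-ι L (2 ℕ.* n)) (sym (ι-2* C)) ⟩
    ι L + ι (2 ℕ.* C)                    ≡⟨ sym (ι-+ L (2 ℕ.* C)) ⟩
    ι (L ℕ.+ 2 ℕ.* C)                    ≡⟨ cong ι (kept-count n) ⟩
    width n                              ∎
    where
    open ≡-Reasoning
    C = count removed (ℕ.suc n)
    L = Data.List.length (Data.List.filter kept? (ℝ.symmetricInterval n))

  -- At most `2 R n ≤ R (2 n + 1)` of the `2 n + 1` integers are removed.
  density≥ : ∀ n → Eventually λ i → 1ℚ ≤ density n + r i
  density≥ n = eventually₂ (λ i C≤ r≥0 → *-cancelʳ-≤-pos (width n) {{width>0 n}} (begin
    1ℚ * width n                                    ≡⟨ trans (*-identityˡ (width n)) (sym (density-width n)) ⟩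
    density n * width n + (C + C)                   ≤⟨ +-monoʳ-≤ (density n * width n) (+-mono-≤ C≤ C≤) ⟩
    density n * width n + (r i * ι n + r i * ι n)   ≡⟨ sym (+-identityˡ _) ⟩
    0ℚ + (density n * width n + (r i * ι n + r i * ι n)) ≤⟨ +-monoˡ-≤ _ r≥0 ⟩
    r i + (density n * width n + (r i * ι n + r i * ι n)) ≡⟨ solve 4 (λ r d w x → r :+ (d :* w :+ (r :* x :+ r :* x)) :=
                                                             d :* w :+ r :* (con 1ℚ :+ (x :+ x))) refl (r i) (density n) (width n) (ι n) ⟩
    density n * width n + r i * (1ℚ + (ι n + ι n))  ≡⟨ cong (λ w → density n * width n + r i * w) (sym (width-≡ n)) ⟩
    density n * width n + r i * width n             ≡⟨ sym (*-distribʳ-+ (width n) (density n) (r i)) ⟩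
    (density n + r i) * width n                     ∎)) (removed≤ n) r≥0
    where
    open ≤-Reasoning
    open +-*-Solver
    C = ι (count removed (ℕ.suc n))

  1≤M : 1ℚ ≤ ι M
  1≤M = subst (_≤ ι M) ι-1 (ι-mono-≤ (ℕ.m^n>0 2 K))

  -- A light block fails its budget, so `R k` exceeds the removals below `k` by at most `2 M`, plus
  -- `2 M` for the error of `q`. Doubling this and adding `R ≤ M` gives `9 M`, which is at most
  -- `h k` by the bound on `ι 9`.
  light⇒r*width≤ : ∀ b h → 0ℚ ≤ h → heavy (ℕ.suc b) ≡ false → ι 9 ≤ ι (ℕ.suc b) * h →
    let k = ℕ.suc b ℕ.* M; C = ι (count removed (ℕ.suc k)) in
    Eventually λ i → r i * width k ≤ C + C + h * width k
  light⇒r*width≤ b′ h h≥0 hb 9≤bh = eventually₂ (λ i r≤ (r≥0 , 2r≤1) → begin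
    r i * width k                             ≡⟨ trans (cong (r i *_) (width-≡ k))
                                                   (solve 2 (λ r x → r :* (con 1ℚ :+ (x :+ x)) := r :+ (r :* x :+ r :* x)) refl (r i) (ι k)) ⟩
    r i + (r i * ι k + r i * ι k)             ≤⟨ +-mono-≤ (r≤m i r≥0 2r≤1) (+-mono-≤ (r*k≤ i r≤) (r*k≤ i r≤)) ⟩
    m + ((t + 4m) + (t + 4m))                 ≡⟨ solve 2 (λ m t →
                                                   m :+ ((t :+ ((m :+ m) :+ (m :+ m))) :+ (t :+ ((m :+ m) :+ (m :+ m)))) :=
                                                   (t :+ t) :+ (con 1ℚ :+ con 1ℚ :+ con 1ℚ :+ con 1ℚ :+ con 1ℚ :+ con 1ℚ :+ con 1ℚ :+ con 1ℚ :+ con 1ℚ) :* m) refl m t ⟩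
    (t + t) + (1ℚ + 1ℚ + 1ℚ + 1ℚ + 1ℚ + 1ℚ + 1ℚ + 1ℚ + 1ℚ) * m ≡⟨ cong (λ n → (t + t) + n * m) (sym 9≡) ⟩
    (t + t) + ι 9 * m                         ≤⟨ +-mono-≤ (+-mono-≤ t≤C t≤C) (*-monoˡ (ι≥0 M) 9≤bh) ⟩
    (C + C) + (ι b * h) * m                   ≡⟨ cong ((C + C) +_) (solve 3 (λ b h m → (b :* h) :* m := h :* (b :* m)) refl (ι b) h m) ⟩
    (C + C) + h * (ι b * m)                   ≡⟨ cong (λ x → (C + C) + h * x) (sym (ι-* b M)) ⟩
    (C + C) + h * ι k                         ≤⟨ +-monoʳ-≤ (C + C) (*-monoʳ h≥0 (ι-mono-≤ k≤1+2k)) ⟩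
    (C + C) + h * width k                     ∎)
    (q≤r b) (eventually₂ (λ _ → _,_) r≥0 R≤1/2)
    where
    open ≤-Reasoning
    open +-*-Solver
    b = ℕ.suc b′
    k = b ℕ.* M
    m = ι M
    t = ι (total b)
    C = ι (count removed (ℕ.suc k))
    4m = (m + m) + (m + m)
    k≤1+2k : k ℕ.≤ ℕ.suc (2 ℕ.* k)
    k≤1+2k = ℕ.m≤n⇒m≤1+n (ℕ.m≤m+n k _)
    9≡ : ι 9 ≡ 1ℚ + 1ℚ + 1ℚ + 1ℚ + 1ℚ + 1ℚ + 1ℚ + 1ℚ + 1ℚ
    9≡ = ι≡/1 9
    t≤C : t ≤ C
    t≤C = subst (λ n → ι n ≤ C) (count-removed b) (ι-mono-≤ (count-mono removed (ℕ.n≤1+n k)))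
    r≤m : ∀ i → 0ℚ ≤ r i → r i + r i ≤ 1ℚ → r i ≤ m
    r≤m i r≥0 2r≤1 = begin
      r i          ≡⟨ sym (+-identityʳ (r i)) ⟩
      r i + 0ℚ     ≤⟨ +-monoʳ-≤ (r i) r≥0 ⟩
      r i + r i    ≤⟨ 2r≤1 ⟩
      1ℚ           ≤⟨ 1≤M ⟩
      m            ∎
    ε*k≤m : ε b * ι k ≤ m
    ε*k≤m = begin
      ε b * ι k        ≡⟨ trans (cong (ε b *_) (ι-* b M)) (sym (*-assoc (ε b) (ι b) m)) ⟩
      ε b * ι b * m    ≤⟨ *-monoˡ (ι≥0 M) (ε*b≤1 b) ⟩
      1ℚ * m           ≡⟨ *-identityˡ m ⟩
      m                ∎
    over-budget : q b * ι k ≤ t + (m + m)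
    over-budget = subst (λ x → q b * ι k ≤ t + x) (ι-2* M)
      (<⇒≤ (≰⇒> (does-false (budget? b (total b)) (trans (sym (heavy-suc b′)) hb))))
    r*k≤ : ∀ i → q b ≤ r i × r i ≤ q b + (ε b + ε b) → r i * ι k ≤ t + 4m
    r*k≤ i (_ , r≤) = begin
      r i * ι k                                    ≤⟨ *-monoˡ (ι≥0 k) r≤ ⟩
      (q b + (ε b + ε b)) * ι k                    ≡⟨ solve 3 (λ q e x → (q :+ (e :+ e)) :* x := q :* x :+ (e :* x :+ e :* x)) refl (q b) (ε b) (ι k) ⟩
      q b * ι k + (ε b * ι k + ε b * ι k)          ≤⟨ +-mono-≤ over-budget (+-mono-≤ ε*k≤m ε*k≤m) ⟩
      t + (m + m) + (m + m)                        ≡⟨ +-assoc t (m + m) (m + m) ⟩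
      t + 4m                                       ∎

  light⇒density≤ : ∀ b h → 0ℚ ≤ h → heavy (ℕ.suc b) ≡ false → ι 9 ≤ ι (ℕ.suc b) * h →
    Eventually λ i → density (ℕ.suc b ℕ.* M) + r i ≤ 1ℚ + h
  light⇒density≤ b h h≥0 hb 9≤bh = let N , le = light⇒r*width≤ b h h≥0 hb 9≤bh in
    N , λ i i≥ → *-cancelʳ-≤-pos w {{width>0 k}} (begin
      (d + r i) * w                ≡⟨ *-distribʳ-+ w d (r i) ⟩
      d * w + r i * w              ≤⟨ +-monoʳ-≤ (d * w) (le i i≥) ⟩
      d * w + (C + C + h * w)      ≡⟨ sym (+-assoc (d * w) (C + C) (h * w)) ⟩
      d * w + (C + C) + h * w      ≡⟨ cong (_+ h * w) (density-width k) ⟩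
      w + h * w                    ≡⟨ solve 2 (λ w h → w :+ h :* w := (con 1ℚ :+ h) :* w) refl w h ⟩
      (1ℚ + h) * w                 ∎)
    where
    open ≤-Reasoning
    open +-*-Solver
    k = ℕ.suc b ℕ.* M
    d = density k
    w = width k
    C = ι (count removed (ℕ.suc k))

  total-heavy-run : ∀ B → (∀ b → B ℕ.≤ b → heavy b ≡ true) → ∀ j → j ℕ.* M ℕ.≤ total (B ℕ.+ j)
  total-heavy-run B all ℕ.zero    = ℕ.z≤n
  total-heavy-run B all (ℕ.suc j) = begin
    M ℕ.+ j ℕ.* M           ≡⟨ ℕ.+-comm M (j ℕ.* M) ⟩
    j ℕ.* M ℕ.+ M           ≤⟨ ℕ.+-monoˡ-≤ M (total-heavy-run B all j) ⟩
    total (B ℕ.+ j) ℕ.+ M   ≡⟨ sym (total-heavy (B ℕ.+ j) (all (B ℕ.+ j) (ℕ.m≤m+n B j))) ⟩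
    total (ℕ.suc (B ℕ.+ j)) ≡⟨ cong total (sym (ℕ.+-suc B j)) ⟩
    total (B ℕ.+ ℕ.suc j)   ∎
    where open ℕ.≤-Reasoning

  -- Heavy blocks from `B` to `2 B` would remove `(B + 1) M` absolute values, while `R ≤ 1/2` allows
  -- only `B M` through block `2 B`.
  ¬eventually-heavy : ∀ B → ¬ (∀ b → B ℕ.≤ b → heavy b ≡ true)
  ¬eventually-heavy B all = contradiction 2T≤ (ℕ.<⇒≱ (begin-strict
    (B ℕ.+ B) ℕ.* M                       ≡⟨ ℕ.*-distribʳ-+ M B B ⟩
    B ℕ.* M ℕ.+ B ℕ.* M                   <⟨ ℕ.+-mono-< B*M< B*M< ⟩
    T ℕ.+ T                               ∎))
    where
    open ℕ.≤-Reasoning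
    T = total (ℕ.suc (B ℕ.+ B))
    B*M< : B ℕ.* M ℕ.< T
    B*M< = ℕ.<-≤-trans (ℕ.m<n+m (B ℕ.* M) (ℕ.m^n>0 2 K))
      (subst (λ n → ℕ.suc B ℕ.* M ℕ.≤ total n) (ℕ.+-suc B B) (total-heavy-run B all (ℕ.suc B)))
    2T≤ : T ℕ.+ T ℕ.≤ (B ℕ.+ B) ℕ.* M
    2T≤ = let N , le = eventually₂ (λ i → double≤ i ((B ℕ.+ B) ℕ.* M)) R≤1/2 (total-suc≤ (B ℕ.+ B)) in
      ι-cancel-≤ (subst (_≤ ι ((B ℕ.+ B) ℕ.* M)) (sym (ι-+ T T)) (le N ℕ.≤-refl))

  limit≤density : ∀ n → fromℕ 1 ℝ.- R ℝ.≤ densityAt Kept kept? n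
  limit≤density n (mk< g g>0 s below) = let N , 1≤ = density≥ n; i = s ℕ.⊔ N in
    contradiction (below i (ℕ.m≤m⊔n s N)) λ lt → <⇒≱ lt (begin
      1ℚ - r i                      ≤⟨ +-monoˡ-≤ (- r i) (1≤ i (ℕ.m≤n⊔m s N)) ⟩
      density n + r i - r i         ≡⟨ solve 2 (λ d r → d :+ r :- r := d) refl (density n) (r i) ⟩
      density n                     ≡⟨ sym (+-identityʳ (density n)) ⟩
      density n + 0ℚ                ≤⟨ +-monoʳ-≤ (density n) (<⇒≤ g>0) ⟩
      density n + g                 ∎)
    where
    open ≤-Reasoning
    open +-*-Solver

  density-< : ∀ k z h → 0ℚ < h → Eventually (λ i → density k + h < approx z i) → densityAt Kept kept? k ℝ.< z
  density-< k z h h>0 (s , below) = mk< h h>0 s below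

  light⇒density< : ∀ b z h → 0ℚ < h → heavy (ℕ.suc b) ≡ false → ι 9 ≤ ι (ℕ.suc b) * h →
    Eventually (λ i → 1ℚ - r i + (h + h) < approx z i) → densityAt Kept kept? (ℕ.suc b ℕ.* M) ℝ.< z
  light⇒density< b z h h>0 hb 9≤ above = density-< k z h h>0 (eventually₂ (λ i d≤ lt → begin-strict
    density k + h               ≡⟨ solve 3 (λ d h r → d :+ h := (d :+ r) :+ (h :- r)) refl (density k) h (r i) ⟩
    density k + r i + (h - r i) ≤⟨ +-monoˡ-≤ (h - r i) d≤ ⟩
    1ℚ + h + (h - r i)          ≡⟨ solve 2 (λ h r → con 1ℚ :+ h :+ (h :- r) := (con 1ℚ :- r) :+ (h :+ h)) refl h (r i) ⟩
    1ℚ - r i + (h + h)          <⟨ lt ⟩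
    approx z i                  ∎) (light⇒density≤ b h (<⇒≤ h>0) hb 9≤) above)
    where
    open ≤-Reasoning
    open +-*-Solver
    k = ℕ.suc b ℕ.* M

  lower-bound⇒heavy : ∀ n z → (∀ k → n ℕ.≤ k → z ℝ.≤ densityAt Kept kept? k) →
    ∀ A h → 0ℚ < h → ι 9 ≤ ι A * h → Eventually (λ i → 1ℚ - r i + (h + h) < approx z i) →
    ∀ b → ℕ.suc (A ℕ.⊔ n) ℕ.≤ b → heavy b ≡ true
  lower-bound⇒heavy n z z≤ A h h>0 9≤ above (ℕ.suc b) (ℕ.s≤s le) = ¬-not λ hb →
    z≤ (ℕ.suc b ℕ.* M) (ℕ.≤-trans (ℕ.m⊔n≤o⇒n≤o A n le) (ℕ.≤-trans (ℕ.n≤1+n b) (ℕ.m≤m*n (ℕ.suc b) M)))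
      (light⇒density< b z h h>0 hb
        (≤-trans 9≤ (*-monoˡ (<⇒≤ h>0) (ι-mono-≤ (ℕ.m≤n⇒m≤1+n (ℕ.m⊔n≤o⇒m≤o A n le))))) above)

  -- A lower bound above `1 - R` would make every late block heavy. This contradiction suffices, as
  -- `≤` is a negation; no light block has to be exhibited.
  limit-greatest : ∀ n z → (∀ k → n ℕ.≤ k → z ℝ.≤ densityAt Kept kept? k) → z ℝ.≤ fromℕ 1 ℝ.- R
  limit-greatest n z z≤ (mk< g g>0 s below) = let A , 9≤ = archimedean 9 (ℝ.0<½* g>0) in
    -- Half of the gap bounds the excess of a light block's density over `1 - R`; the other half
    -- makes the inequality strict.
    ¬eventually-heavy (ℕ.suc (A ℕ.⊔ n)) (lower-bound⇒heavy n z z≤ A (½ * g) (ℝ.0<½* g>0) 9≤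
      (s , λ i i≥ → subst (λ g → 1ℚ - r i + g < approx z i) (sym (ℝ.½+½ g)) (below i i≥)))

  -- All tail infima equal `1 - R`, so their sequence is constant.
  lower-density : HasLowerDensity Kept kept? (fromℕ 1 ℝ.- R)
  lower-density = (λ _ → fromℕ 1 ℝ.- R) , (λ n → (λ k _ → limit≤density k) , limit-greatest n) ,
    λ e (mk< g g>0 s below) → s , λ _ _ → mk< g g>0 s λ i i≥ →
      subst (λ p → ∣ p ∣ + g < approx e i) (sym (+-inverseʳ (approx (fromℕ 1 ℝ.- R) i))) (below i i≥)

  permutable-set : Σ[ S ∈ Pred ℤ 0ℓ ] Σ[ S? ∈ Decidable S ] (Permutable 4 S × HasLowerDensity S S? (fromℕ 1 ℝ.- R))
  permutable-set = Kept , kept? , permutable , lower-density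

-- Bounds for the rate.

module RemovalRate where

  open RationalLemmas
  open import Defs using (recip; *-recip; 0<*)
  open import Data.Rational
  open import Data.Rational.Properties
  open import Data.Rational.Solver using (module +-*-Solver)
  open import Relation.Binary.PropositionalEquality

  2ℚ : ℚ
  2ℚ = 1ℚ + 1ℚ

  p≤q⇒0≤q-p : ∀ {p q} → p ≤ q → 0ℚ ≤ q - p
  p≤q⇒0≤q-p {p} {q} p≤q = subst (_≤ q - p) (+-inverseʳ p) (+-monoˡ-≤ (- p) p≤q)

  p<q⇒0<q-p : ∀ {p q} → p < q → 0ℚ < q - p
  p<q⇒0<q-p {p} {q} p<q = subst (_< q - p) (+-inverseʳ p) (+-monoˡ-< (- p) p<q)

  p≤p+q : ∀ {p q} → 0ℚ ≤ q → p ≤ p + q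
  p≤p+q {p} {q} q≥0 = subst (_≤ p + q) (+-identityʳ p) (+-monoʳ-≤ p q≥0)

  rate : ℚ → ℚ → ℚ → ℚ
  rate m a c = a * (c - 1ℚ) * recip (2ℚ * m * c * (a - 1ℚ))

  module _ {m a c : ℚ} (1≤m : 1ℚ ≤ m) (1<a : 1ℚ < a) (2≤c : 2ℚ ≤ c) (c≤a : c ≤ a) where

    open ≤-Reasoning
    open +-*-Solver

    0<1 : 0ℚ < 1ℚ
    0<1 = positive⁻¹ 1ℚ

    0<2 : 0ℚ < 2ℚ
    0<2 = positive⁻¹ 2ℚ

    c>0 : 0ℚ < c
    c>0 = <-≤-trans 0<2 2≤c

    m>0 : 0ℚ < m
    m>0 = <-≤-trans 0<1 1≤m

    D : ℚ
    D = 2ℚ * m * c * (a - 1ℚ)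

    D>0 : 0ℚ < D
    D>0 = 0<* (0<* (0<* 0<2 m>0) c>0) (p<q⇒0<q-p 1<a)

    rate*D : rate m a c * D ≡ a * (c - 1ℚ)
    rate*D = trans (*-assoc (a * (c - 1ℚ)) (recip D) D)
      (trans (cong (a * (c - 1ℚ) *_) (trans (*-comm (recip D) D) (*-recip D>0))) (*-identityʳ (a * (c - 1ℚ))))

    -- The difference `4 m a (c - 1) - D` is `2 m (a (c - 2) + c)`, nonnegative because `c ≥ 2`.
    1≤rate*4m : 1ℚ ≤ rate m a c * (2ℚ * (2ℚ * m))
    1≤rate*4m = *-cancelʳ-≤-pos D {{positive D>0}} (begin
      1ℚ * D                                              ≡⟨ *-identityˡ D ⟩
      D                                                   ≤⟨ p≤p+q (*≥0 (<⇒≤ (0<* 0<2 m>0)) (+-mono-≤ (*≥0 (<⇒≤ (<-trans 0<1 1<a)) (p≤q⇒0≤q-p 2≤c)) (<⇒≤ c>0))) ⟩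
      D + 2ℚ * m * (a * (c - 2ℚ) + c)                     ≡⟨ solve 3 (λ m a c → let 2′ = con 1ℚ :+ con 1ℚ in
                                                               2′ :* m :* c :* (a :- con 1ℚ) :+ 2′ :* m :* (a :* (c :- 2′) :+ c) :=
                                                               a :* (c :- con 1ℚ) :* (2′ :* (2′ :* m))) refl m a c ⟩
      a * (c - 1ℚ) * (2ℚ * (2ℚ * m))                      ≡⟨ cong (_* (2ℚ * (2ℚ * m))) (sym rate*D) ⟩
      rate m a c * D * (2ℚ * (2ℚ * m))                    ≡⟨ solve 3 (λ x d y → x :* d :* y := x :* y :* d) refl (rate m a c) D (2ℚ * (2ℚ * m)) ⟩
      rate m a c * (2ℚ * (2ℚ * m)) * D                    ∎)

    -- The difference `D - 2 a (c - 1)` is `2 (m - 1) c (a - 1) + 2 (a - c)`, nonnegative because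
    -- `m ≥ 1` and `c ≤ a`.
    rate+rate≤1 : rate m a c + rate m a c ≤ 1ℚ
    rate+rate≤1 = *-cancelʳ-≤-pos D {{positive D>0}} (begin
      (rate m a c + rate m a c) * D                       ≡⟨ *-distribʳ-+ D (rate m a c) (rate m a c) ⟩
      rate m a c * D + rate m a c * D                     ≡⟨ cong₂ _+_ rate*D rate*D ⟩
      a * (c - 1ℚ) + a * (c - 1ℚ)                         ≤⟨ p≤p+q (+-mono-≤ (*≥0 (<⇒≤ 0<2) (*≥0 (*≥0 (p≤q⇒0≤q-p 1≤m) (<⇒≤ c>0)) (<⇒≤ (p<q⇒0<q-p 1<a))))
                                                               (*≥0 (<⇒≤ 0<2) (p≤q⇒0≤q-p c≤a))) ⟩
      a * (c - 1ℚ) + a * (c - 1ℚ) + (2ℚ * ((m - 1ℚ) * c * (a - 1ℚ)) + 2ℚ * (a - c))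
                                                          ≡⟨ solve 3 (λ m a c → let 2′ = con 1ℚ :+ con 1ℚ in
                                                               a :* (c :- con 1ℚ) :+ a :* (c :- con 1ℚ) :+
                                                                 (2′ :* ((m :- con 1ℚ) :* c :* (a :- con 1ℚ)) :+ 2′ :* (a :- c)) :=
                                                               2′ :* m :* c :* (a :- con 1ℚ)) refl m a c ⟩
      D                                                   ≡⟨ sym (*-identityˡ D) ⟩
      1ℚ * D                                              ∎)

-- From the real parameters to the greedy set.

open import Defs

module _ where

  open RationalLemmas
  open RemovalRate
  import Data.Nat.Properties as ℕ
  import Data.Rational.Properties as ℚ
  open import Relation.Binary.PropositionalEquality
  open ℚ.≤-Reasoning

  approx-* : ∀ x y i → approx (x * y) i ≡ approx x i ℚ.* approx y i
  approx-* x y i = refl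

  approx-minus : ∀ x y i → approx (x - y) i ≡ approx x i ℚ.- approx y i
  approx-minus x y i = refl

  approx-/ : ∀ x y (y>0 : 0ℝ < y) i → approx (x / y [ y>0 ]) i ≡ approx x i ℚ.* recip (approx y i)
  approx-/ x y y>0 i = refl

  -- Real operations act index by index, so the rational bounds apply to each approximation.
  approx-rate : ∀ m a c (D>0 : 0ℝ < fromℕ 2 * fromℕ m * c * (fromℕ a - fromℕ 1)) i →
    approx ((fromℕ a * (c - fromℕ 1)) / (fromℕ 2 * fromℕ m * c * (fromℕ a - fromℕ 1)) [ D>0 ]) i ≡
    rate (approx (fromℕ m) i) (approx (fromℕ a) i) (approx c i)
  approx-rate m a c D>0 i = trans (approx-/ (fromℕ a * (c - fromℕ 1)) (fromℕ 2 * fromℕ m * c * (fromℕ a - fromℕ 1)) D>0 i)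
    (cong₂ (λ p q → p ℚ.* recip q)
      (trans (approx-* (fromℕ a) (c - fromℕ 1) i) (cong (approx (fromℕ a) i ℚ.*_) (x-1 c)))
      (trans (approx-* (fromℕ 2 * fromℕ m * c) (fromℕ a - fromℕ 1) i) (cong₂ ℚ._*_
        (trans (approx-* (fromℕ 2 * fromℕ m) c i) (cong (ℚ._* approx c i)
          (trans (approx-* (fromℕ 2) (fromℕ m) i) (cong (ℚ._* approx (fromℕ m) i) 2≡2ℚ))))
        (x-1 (fromℕ a)))))
    where
    2≡2ℚ : approx (fromℕ 2) i ≡ 2ℚ
    2≡2ℚ = refl
    x-1 : ∀ x → approx (x - fromℕ 1) i ≡ approx x i ℚ.- 1ℚ
    x-1 x = approx-minus x (fromℕ 1) i

  1<ι : ∀ {a} → 2 ℕ.≤ a → 1ℚ ℚ.< approx (fromℕ a) 0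
  1<ι {a} 2≤a = ℚ.<-≤-trans 1<2 (subst₂ ℚ._≤_ (ι≡/1 2) (ι≡/1 a) (ι-mono-≤ 2≤a))
    where
    1<2 : 1ℚ ℚ.< 2ℚ
    1<2 = ℚ.*<* (ℤ.+<+ (ℕ.s≤s (ℕ.s≤s ℕ.z≤n)))

  -- Taking `2 + k` binary digits gives `M = 4 m`, for which the rate is at least `1 / M`.
  permutable-of-rate : ∀ m k a c → 2 ℕ.≤ m → m ≡ 2 ℕ.^ k → 2 ℕ.≤ a →
    Eventually (λ i → 2ℚ ℚ.≤ approx c i) → Eventually (λ i → approx c i ℚ.≤ approx (fromℕ a) i) →
    ∀ R → (∀ i → approx R i ≡ rate (approx (fromℕ m) i) (approx (fromℕ a) i) (approx c i)) →
    Σ[ S ∈ Pred ℤ 0ℓ ] Σ[ S? ∈ Decidable S ] (Permutable 4 S × HasLowerDensity S S? (fromℕ 1 - R))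
  permutable-of-rate m k a c 2≤m m≡2^k 2≤a 2≤c c≤a R R≡rate = Density.permutable-set (2 ℕ.+ k) R
    (eventually₂ (λ i 2≤c c≤a → subst₂ (λ x y → 1ℚ ℚ.≤ x ℚ.* y) (sym (R≡rate i)) (sym ι-4m)
      (1≤rate*4m 1≤m (1<ι 2≤a) 2≤c c≤a)) 2≤c c≤a)
    (eventually₂ (λ i 2≤c c≤a → subst (λ x → x ℚ.+ x ℚ.≤ 1ℚ) (sym (R≡rate i))
      (rate+rate≤1 1≤m (1<ι 2≤a) 2≤c c≤a)) 2≤c c≤a)
    where
    1≤m : 1ℚ ℚ.≤ approx (fromℕ m) 0
    1≤m = ℚ.<⇒≤ (1<ι 2≤m)
    ι-4m : ι (2 ℕ.^ (2 ℕ.+ k)) ≡ 2ℚ ℚ.* (2ℚ ℚ.* approx (fromℕ m) 0)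
    ι-4m = trans (ι-* 2 (2 ℕ.* 2 ℕ.^ k)) (cong₂ ℚ._*_ (ι≡/1 2)
      (trans (ι-* 2 (2 ℕ.^ k)) (cong₂ ℚ._*_ (ι≡/1 2) (trans (cong ι (sym m≡2^k)) (ι≡/1 m)))))

  eventually-≤ : ∀ {x y} → x < y → Eventually λ i → approx x i ℚ.≤ approx y i
  eventually-≤ (mk< g g>0 s below) = s , λ i i≥ → ℚ.≤-trans (p≤p+q (ℚ.<⇒≤ g>0)) (ℚ.<⇒≤ (below i i≥))

  eventually-2≤ : ∀ {x y} → 0ℝ < y → fromℕ 2 + y < x → Eventually λ i → 2ℚ ℚ.≤ approx x i
  eventually-2≤ {x} {y} y>0 2+y<x = eventually₂ (λ i y≥0 le → ℚ.≤-trans (p≤p+q y≥0) le)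
    (eventually-≤ {0ℝ} {y} y>0) (eventually-≤ {fromℕ 2 + y} {x} 2+y<x)

theorem1p2 : (m : ℕ) (2≤m : 2 ℕ.≤ m) → (∃[ k ] m ≡ 2 ℕ.^ k) →
    (a : ℕ) (4≤a : 4 ℕ.≤ a) →
    (c : ℝ) (2+1/a<c : fromℕ 2 + fromℕ 1 / fromℕ a [ ≥4⇒pos 4≤a ] < c) → c < fromℕ a →
    Σ[ S ∈ Pred ℤ 0ℓ ] Σ[ S? ∈ Decidable S ]
    (Permutable 4 S ×
    HasLowerDensity S S?
    (fromℕ 1 - (fromℕ a * (c - fromℕ 1))
    / (fromℕ 2 * fromℕ m * c * (fromℕ a - fromℕ 1)) [ denominator-pos m a c 2≤m 4≤a 2+1/a<c ]))
theorem1p2 m 2≤m (k , m≡2^k) a 4≤a c 2+1/a<c c<a =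
  permutable-of-rate m k a c 2≤m m≡2^k (ℕ.≤-trans (ℕ.s≤s (ℕ.s≤s ℕ.z≤n)) 4≤a)
    (eventually-2≤ {c} {fromℕ 1 / fromℕ a [ ≥4⇒pos 4≤a ]} 1/a>0 2+1/a<c) (eventually-≤ {c} {fromℕ a} c<a)
    ((fromℕ a * (c - fromℕ 1)) / (fromℕ 2 * fromℕ m * c * (fromℕ a - fromℕ 1)) [ denominator-pos m a c 2≤m 4≤a 2+1/a<c ])
    (approx-rate m a c (denominator-pos m a c 2≤m 4≤a 2+1/a<c))
  where
  import Data.Nat.Properties as ℕ
  1/a>0 : 0ℝ < fromℕ 1 / fromℕ a [ ≥4⇒pos 4≤a ]
  1/a>0 = *-pos {fromℕ 1} {fromℕ a ⁻¹[ ≥4⇒pos 4≤a ]} (fromℕ-< 0 1 (ℕ.s≤s ℕ.z≤n)) (⁻¹-pos {fromℕ a} (≥4⇒pos 4≤a))
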